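{- Let $G$ be a TDAG and let $k\geq 2$ be an integer. Then $SPW(G)\geq k$ if and only if some variant of $G_{SP(k)}$ is a d-minor of $G$.
   Context: A 2-terminal directed graph $G=\langle V,E,s,t\rangle$ is a directed multigraph without self-loops with two distinguished vertices $s,t$ such that every vertex and every edge lies on at least one simple directed $s$–$t$ path. A TDAG is a 2-terminal directed graph with no directed cycle. Cuts and widths: a cut is a set $C\subseteq E$ such that there is no directed $s$–$t$ path using only edges of $E\setminus C$; it is minimal if no proper subset of it is a cut. A set $S\subseteq E$ is parallel if $S\subseteq C$ for some minimal cut $C$, and serial if there is a simple directed $s$–$t$ path containing all edges of $S$. $SPW(G)$ (serial-parallel width) is the maximum size of a set $S\subseteq E$ that is both serial and parallel. d-minors: $G'$ is a d-minor of $G$ if a graph isomorphic to $G'$ is obtained from $G$ by a finite (possibly empty) sequence of the operations: (Deletion) delete an edge $(a,b)$ where $a$ has outdegree at least 2 and $b$ has indegree at least 2; (Backward contraction) contract an edge $(a,b)$ where $b$ has indegree 1; (Forward contraction) contract an edge $(a,b)$ where $a$ has outdegree 1. Contracting $(a,b)$ merges $a$ and $b$ into one vertex incident to all other edges of $a$ and $b$. The graph $G_{SP(k)}$: write $a_1=s$ and $b_k=t$; the vertex set is $\{s,t,a_2,\dots,a_k,b_1,\dots,b_{k-1}\}$ and the edges are $(s,a_i)$ for $2\le i\le k$, $(b_i,t)$ for $1\le i\le k-1$, $(a_i,b_i)$ for $1\le i\le k$, and $(b_i,a_{i+1})$ for $1\le i\le k-1$ (for $k=2$ this is the Braess graph).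 A variant of $G_{SP(k)}$ is obtained by replacing the edges $\{(s,a_i)\}_{i=2}^k$ with an arbitrary directed tree rooted at $s=a_1$ spanning $\{a_1,\dots,a_k\}$ in which every edge goes from some $a_j$ to some $a_i$ with $j<i$, and replacing the edges $\{(b_i,t)\}_{i=1}^{k-1}$ with an arbitrary directed in-tree toward $t=b_k$ spanning $\{b_1,\dots,b_k\}$ in which every edge goes from some $b_i$ to some $b_j$ with $j>i$ (the edges $(a_i,b_i)$ and $(b_i,a_{i+1})$ are kept). -}

module Defs where

open import Data.Nat using (ℕ; zero; suc; _≤_)
open import Data.Fin using (Fin; zero; suc; punchIn; punchOut; _≟_; _↑ˡ_; _↑ʳ_; inject₁; fromℕ; toℕ)
open import Data.Fin.Subset as Sub using (Subset; _⊆_; _⊂_; ∣_∣)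
open import Data.List using (List; []; _∷_; map; length; filter; lookup; allFin; _++_)
open import Data.List.Membership.Propositional as LMem using ()
open import Data.List.Relation.Unary.Any using (Any)
open import Data.List.Relation.Unary.Unique.Propositional using (Unique)
open import Data.Product using (Σ; ∃; ∃-syntax; _×_; _,_; proj₁; proj₂)
open import Data.Empty using (⊥)
open import Relation.Nullary using (¬_; yes; no)
open import Relation.Binary.PropositionalEquality using (_≡_; _≢_; sym)
open import Relation.Binary.Construct.Closure.ReflexiveTransitive using (Star)
open import Function using (_∘_)
open import Function.Bundles using (_↔_; Inverse)

record Graph : Set where
  constructor mkG
  field
    nv  : ℕ
    ne  : ℕ
    src : Fin ne → Fin nv
    tgt : Fin ne → Fin nv
    s   : Fin nv
    t   : Fin nv

open Graph public

module _ (G : Graph) where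

  IsWalk : Fin (nv G) → Fin (nv G) → List (Fin (ne G)) → Set
  IsWalk u v []       = u ≡ v
  IsWalk u v (e ∷ es) = src G e ≡ u × IsWalk (tgt G e) v es

  walkVertices : Fin (nv G) → List (Fin (ne G)) → List (Fin (nv G))
  walkVertices u es = u ∷ map (tgt G) es

  IsSimplePath : Fin (nv G) → Fin (nv G) → List (Fin (ne G)) → Set
  IsSimplePath u v es = IsWalk u v es × Unique (walkVertices u es)

  IsSTPath : List (Fin (ne G)) → Set
  IsSTPath = IsSimplePath (s G) (t G)

  TwoTerminal : Set
  TwoTerminal =
    (∀ e → src G e ≢ tgt G e) ×
    (∀ v → ∃[ es ] (IsSTPath es × v LMem.∈ walkVertices (s G) es)) ×
    (∀ e → ∃[ es ] (IsSTPath es × e LMem.∈ es))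

  Acyclic : Set
  Acyclic = ∀ v es → IsWalk v v es → es ≡ []

  TDAG : Set
  TDAG = TwoTerminal × Acyclic

  IsCut : Subset (ne G) → Set
  IsCut C = ∀ es → IsSTPath es → Any (Sub._∈ C) es

  IsMinimalCut : Subset (ne G) → Set
  IsMinimalCut C = IsCut C × (∀ C' → C' ⊂ C → ¬ IsCut C')

  Parallel : Subset (ne G) → Set
  Parallel S = ∃[ C ] (IsMinimalCut C × S ⊆ C)

  Serial : Subset (ne G) → Set
  Serial S = ∃[ es ] (IsSTPath es × (∀ e → e Sub.∈ S → e LMem.∈ es))

  -- SPW(G) ≥ k  (SPW(G) is the maximum size of a serial and parallel set)
  SPW≥ : ℕ → Set
  SPW≥ k = ∃[ S ] (Serial S × Parallel S × k ≤ ∣ S ∣)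

  outdeg : Fin (nv G) → ℕ
  outdeg v = length (filter (λ e → src G e ≟ v) (allFin (ne G)))

  indeg : Fin (nv G) → ℕ
  indeg v = length (filter (λ e → tgt G e ≟ v) (allFin (ne G)))

merge : ∀ {n} (a b : Fin (suc n)) → a ≢ b → Fin (suc n) → Fin n
merge a b a≢b v with b ≟ v
... | yes _   = punchOut {i = b} {j = a} (λ eq → a≢b (sym eq))
... | no b≢v = punchOut b≢v

contract : ∀ {n m} (src tgt : Fin (suc m) → Fin (suc n)) (s t : Fin (suc n))
           (e : Fin (suc m)) → src e ≢ tgt e → Graph
contract {n} {m} src tgt s t e ne =
  mkG n m (f ∘ src ∘ punchIn e) (f ∘ tgt ∘ punchIn e) (f s) (f t)
  where f = merge (src e) (tgt e) ne

data Step : Graph → Graph → Set where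
  deletion : ∀ {n m} (src tgt : Fin (suc m) → Fin n) (s t : Fin n)
             (e : Fin (suc m)) →
             let G = mkG n (suc m) src tgt s t in
             2 ≤ outdeg G (src e) → 2 ≤ indeg G (tgt e) →
             Step G (mkG n m (src ∘ punchIn e) (tgt ∘ punchIn e) s t)
  backwardContraction : ∀ {n m} (src tgt : Fin (suc m) → Fin (suc n))
             (s t : Fin (suc n)) (e : Fin (suc m)) (ne : src e ≢ tgt e) →
             indeg (mkG (suc n) (suc m) src tgt s t) (tgt e) ≡ 1 →
             Step (mkG (suc n) (suc m) src tgt s t) (contract src tgt s t e ne)
  forwardContraction : ∀ {n m} (src tgt : Fin (suc m) → Fin (suc n))
             (s t : Fin (suc n)) (e : Fin (suc m)) (ne : src e ≢ tgt e) →
             outdeg (mkG (suc n) (suc m) src tgt s t) (src e) ≡ 1 →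
             Step (mkG (suc n) (suc m) src tgt s t) (contract src tgt s t e ne)

record Iso (G H : Graph) : Set where
  field
    vmap : Fin (nv G) ↔ Fin (nv H)
    emap : Fin (ne G) ↔ Fin (ne H)
    src-pres : ∀ e → src H (Inverse.to emap e) ≡ Inverse.to vmap (src G e)
    tgt-pres : ∀ e → tgt H (Inverse.to emap e) ≡ Inverse.to vmap (tgt G e)
    s-pres   : Inverse.to vmap (s G) ≡ s H
    t-pres   : Inverse.to vmap (t G) ≡ t H

DMinor : Graph → Graph → Set
DMinor H G = ∃[ G' ] (Star Step G G' × Iso G' H)

-- Variants of G_SP(k), with k = suc n (vertices indexed from 0):
-- a_i = i ↑ˡ k, b_i = k ↑ʳ i for i : Fin k; s = a_0, t = b_{k-1}.
-- The out-tree on the a's is given by a parent function: the vertex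
-- a_{i+1} (i : Fin n) has parent a_{pa i}; the in-tree on the b's is
-- given by: b_i (i : Fin n, i.e. i < k-1) has its out-edge to b_{pb i}.

graphOfList : (nv : ℕ) → List (Fin nv × Fin nv) → Fin nv → Fin nv → Graph
graphOfList nv es s t =
  mkG nv (length es) (proj₁ ∘ lookup es) (proj₂ ∘ lookup es) s t

SPVariant : (n : ℕ) → (pa pb : Fin n → Fin (suc n)) → Graph
SPVariant n pa pb =
  graphOfList (suc n Data.Nat.+ suc n)
    (treeA ++ treeB ++ rungs ++ back) (a zero) (b (fromℕ n))
  where
  a b : Fin (suc n) → Fin (suc n Data.Nat.+ suc n)
  a i = i ↑ˡ suc n
  b i = suc n ↑ʳ i
  treeA = map (λ i → a (pa i) , a (suc i)) (allFin n)
  treeB = map (λ i → b (inject₁ i) , b (pb i)) (allFin n)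
  rungs = map (λ i → a i , b i) (allFin (suc n))
  back  = map (λ i → b (inject₁ i) , a (suc i)) (allFin n)

-- validity: tree edges go from lower to higher index among the a's,
-- and from lower to higher index among the b's
ValidVariant : (n : ℕ) → (pa pb : Fin n → Fin (suc n)) → Set
ValidVariant n pa pb =
  (∀ i → toℕ (pa i) ≤ toℕ i) × (∀ i → suc (toℕ i) ≤ toℕ (pb i))

SomeSPVariantDMinor : ℕ → Graph → Set
SomeSPVariantDMinor k G =
  ∃[ n ] (suc n ≡ k × ∃[ pa ] ∃[ pb ] (ValidVariant n pa pb × DMinor (SPVariant n pa pb) G))

{-# OPTIONS --safe #-}
-- In a variant the rungs (a_i , b_i) are serial and form a cut along which each rung is essential: a
-- set X of vertices such that inside X the source reaches the tail of every rung and outside X the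
-- head of every rung reaches the sink.  Such a set pulls back along each operation, and it always
-- contains a minimal cut through all the rungs.
--
-- Conversely let P be a path through k edges of a minimal cut, B the set of vertices that reach the
-- sink without using the cut, and X the complement of B.  After a shortcut inside X, P crosses from X
-- to B exactly k times.  Inside X choose an out-tree from the source that follows P wherever P is
-- reachable in X, and dually an in-tree to the sink inside B.  The two trees together with P form a
-- subgraph in which every vertex other than the source (sink) has an edge in (out).  An edge outside
-- such a subgraph can be deleted, or contracted away with an unused endpoint; when no such edge is
-- left, the tree edges are contracted segment by segment, and what remains is a variant.  Acyclicity
-- keeps the segments of P disjoint and orients the tree edges between them by increasing index.
module Submission where

open import Defs
open import Data.Nat using (ℕ; zero; suc; _+_; _≤_; z≤n; s≤s)
import Data.Nat.Properties as ℕ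
open import Data.Bool using (Bool; true; false; not)
import Data.Bool as Bool
open import Data.Fin using (Fin; zero; suc; punchIn; punchOut; _≟_; _<_; inject₁; fromℕ; toℕ; _↑ˡ_; _↑ʳ_; splitAt)
open import Data.Fin.Induction using (spo-wellFounded)
import Data.Fin.Properties as Fin
open import Data.Fin.Properties using (punchInᵢ≢i; punchIn-injective; punchIn-punchOut; punchOut-punchIn; punchOut-cong)
open import Data.Fin.Relation.Unary.Top using (‵fromℕ; ‵inject₁) renaming (view to topView)
open import Data.Fin.Subset as Sub using (Subset; inside; outside; ∣_∣; _∪_; ⁅_⁆; _⊆_)
open import Data.Fin.Subset.Properties using (_∈?_; x∈⁅x⁆; x∈⁅y⁆⇒x≡y; x∈p∪q⁺; x∈p∪q⁻; p⊂q⇒∣p∣<∣q∣; ∣p∣≤n; x∈p∧x≢y⇒x∈p-y; x∈p⇒∣p-x∣<∣p∣; p─⊥≡p; p─q⊆p; Empty-unique; ∣⊥∣≡0)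
open import Data.Vec using ([]; _∷_; tabulate)
import Data.Vec as Vec
open import Data.Vec.Properties using ([]=⇒lookup; lookup⇒[]=; lookup∘tabulate)
open import Data.Maybe using (Maybe; just; nothing)
import Data.Maybe.Properties as Maybe
open import Data.Unit using (⊤; tt)
open import Data.Empty using (⊥; ⊥-elim)
open import Data.Product using (∃-syntax; _×_; _,_; proj₁; proj₂)
open import Data.Sum using (_⊎_; inj₁; inj₂; [_,_]′)
import Data.Sum as Sum
open import Data.List using (List; []; _∷_; _++_; map; length; lookup; filter; allFin)
import Data.List as List
open import Data.List.Membership.Propositional using (_∈_)
open import Data.List.Membership.Propositional.Properties using (∈-allFin; ∈-filter⁺; ∈-filter⁻; ∈-++⁺ʳ)
open import Data.List.Relation.Unary.All using (All; []; _∷_)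
import Data.List.Relation.Unary.All as All
open import Data.List.Relation.Unary.All.Properties using () renaming (++⁺ to All-++⁺)
open import Data.List.Relation.Unary.AllPairs using ([]; _∷_)
open import Data.List.Relation.Unary.Any using (Any; here; there)
import Data.List.Relation.Unary.Any as Any
open import Data.List.Relation.Unary.Unique.Propositional using (Unique)
open import Data.List.Relation.Unary.Unique.Propositional.Properties using (filter⁺; allFin⁺)
open import Induction.WellFounded using (WellFounded; Acc; acc)
open import Relation.Nullary using (¬_; Dec; yes; no; does; contradiction; ¬?; _×-dec_; _⊎-dec_)
open import Relation.Nullary.Decidable using (dec-true; decidable-stable; toSum)
open import Relation.Unary using (Decidable)
open import Relation.Binary.Definitions using (tri<; tri≈; tri>)
open import Relation.Binary.PropositionalEquality using (_≡_; _≢_; refl; sym; trans; cong; subst; subst₂; isEquivalence; resp₂)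
open import Relation.Binary.Construct.Closure.ReflexiveTransitive using (Star; ε; _◅_; _◅◅_)
open import Function using (_∘_; id; flip; const)
open import Function.Bundles using (_⇔_; mk⇔; mk↔ₛ′; Inverse)

-- Walks

-- A minimal cut does not pull back along a deletion, since the deleted edge may join the two sides
-- anew. A vertex set does, by taking preimages; this is why the invariant for minors is a set of
-- vertices and a minimal cut is extracted only at the end. Moreover a segment of P may begin where
-- the root cannot get without leaving X, so it need not be a branch of the out-tree. The fibre of a
-- tree vertex therefore has an initial piece of the segment, contracted forward, and then the part
-- from the first reachable vertex on with the branches hanging there, contracted backward.
-- Reversing all edges exchanges source and sink, the two contractions and the two sides of the cut,
-- so that most arguments are made only once.

Vertex Edge : Graph → Set
Vertex G = Fin (nv G)
Edge G = Fin (ne G)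

op : Graph → Graph
op G = mkG (nv G) (ne G) (tgt G) (src G) (t G) (s G)

record Link (G : Graph) (P : Vertex G → Set) (u v : Vertex G) : Set where
  constructor link
  field
    edge  : Edge G
    src≡  : src G edge ≡ u
    tgt≡  : tgt G edge ≡ v
    src∈  : P u
    tgt∈  : P v

Walk : (G : Graph) (P : Vertex G → Set) → Vertex G → Vertex G → Set
Walk G P = Star (Link G P)

Reach : (G : Graph) → Vertex G → Vertex G → Set
Reach G = Walk G (λ _ → ⊤)

edgeWalk : ∀ {G} {P : Vertex G → Set} e → P (src G e) → P (tgt G e) →
           Walk G P (src G e) (tgt G e)
edgeWalk e p q = link e refl refl p q ◅ ε

edgeReach : ∀ {G} e → Reach G (src G e) (tgt G e)
edgeReach e = edgeWalk e tt tt

weaken : ∀ {G} {P Q : Vertex G → Set} → (∀ {v} → P v → Q v) →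
         ∀ {u v} → Walk G P u v → Walk G Q u v
weaken f ε = ε
weaken f (link e a b p q ◅ w) = link e a b (f p) (f q) ◅ weaken f w

forget : ∀ {G} {P : Vertex G → Set} {u v} → Walk G P u v → Reach G u v
forget = weaken (λ _ → tt)

reverse : ∀ {G} {P : Vertex G → Set} {u v} → Walk G P u v → Walk (op G) P v u
reverse ε = ε
reverse (link e a b p q ◅ w) = reverse w ◅◅ (link e b a q p ◅ ε)

last-edge : ∀ {G} {u v} → Reach G u v → u ≡ v ⊎ ∃[ e ] (Reach G u (src G e) × tgt G e ≡ v)
last-edge ε = inj₁ refl
last-edge (link e refl refl _ _ ◅ w) with last-edge w
... | inj₁ refl = inj₂ (e , ε , refl)
... | inj₂ (e' , w' , eq) = inj₂ (e' , edgeReach e ◅◅ w' , eq)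

-- Acyclicity makes every walk simple, so the simple paths of `TDAG` can be replaced by plain walks.
-- In this form the property passes through each operation and is symmetric under `op`.
record Flow (G : Graph) : Set where
  field
    acyclic : ∀ e → ¬ Reach G (tgt G e) (src G e)
    from-s  : ∀ v → Reach G (s G) v
    to-t    : ∀ v → Reach G v (t G)

open Flow

opFlow : ∀ {G} → Flow G → Flow (op G)
opFlow F = record
  { acyclic = λ e w → acyclic F e (reverse w)
  ; from-s  = λ v → reverse (to-t F v)
  ; to-t    = λ v → reverse (from-s F v)
  }

module _ {G : Graph} where

  s-source : Flow G → ∀ e → tgt G e ≢ s G
  s-source F e eq = acyclic F e (subst (λ v → Reach G v (src G e)) (sym eq) (from-s F (src G e)))

  t-sink : Flow G → ∀ e → src G e ≢ t G
  t-sink F e eq = acyclic F e (subst (Reach G (tgt G e)) (sym eq) (to-t F (tgt G e)))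

  has-in-edge : Flow G → ∀ v → v ≢ s G → ∃[ e ] tgt G e ≡ v
  has-in-edge F v v≢s with last-edge (from-s F v)
  ... | inj₁ eq = contradiction (sym eq) v≢s
  ... | inj₂ (e , _ , eq) = e , eq

  src≢tgt : Flow G → ∀ e → src G e ≢ tgt G e
  src≢tgt F e eq = acyclic F e (subst (Reach G (tgt G e)) (sym eq) ε)

  toList : ∀ {P : Vertex G → Set} {u v} → Walk G P u v →
           ∃[ es ] (IsWalk G u v es × All (λ e → P (src G e) × P (tgt G e)) es)
  toList ε = [] , refl , []
  toList (link e refl refl p q ◅ w) with toList w
  ... | es , ok , ps = e ∷ es , (refl , ok) , (p , q) ∷ ps

  fromList : ∀ {P : Vertex G → Set} {u v} es → IsWalk G u v es →
             All (λ e → P (src G e) × P (tgt G e)) es → Walk G P u v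
  fromList [] refl [] = ε
  fromList (e ∷ es) (refl , ok) ((p , q) ∷ ps) = link e refl refl p q ◅ fromList es ok ps

  listReach : ∀ {u v} es → IsWalk G u v es → Reach G u v
  listReach es ok = fromList es ok (All.universal (λ _ → tt , tt) es)

  walk-++ : ∀ {u v w} es fs → IsWalk G u v es → IsWalk G v w fs → IsWalk G u w (es ++ fs)
  walk-++ [] fs refl q = q
  walk-++ (e ∷ es) fs (a , p) q = a , walk-++ es fs p q

  walk-head : ∀ {u v} es → IsWalk G u v es → ∀ {e} → e ∈ es → Reach G u (src G e)
  walk-head (e ∷ es) (refl , ok) (here refl) = ε
  walk-head (e ∷ es) (refl , ok) (there m) = edgeReach e ◅◅ walk-head es ok m

  walk-tail : ∀ {u v} es → IsWalk G u v es → ∀ {e} → e ∈ es → Reach G (tgt G e) v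
  walk-tail (e ∷ es) (refl , ok) (here refl) = listReach es ok
  walk-tail (e ∷ es) (refl , ok) (there m) = walk-tail es ok m

  map-tgt : ∀ {Q : Vertex G → Set} es → (∀ {e} → e ∈ es → Q (tgt G e)) → All Q (map (tgt G) es)
  map-tgt [] q = []
  map-tgt (e ∷ es) q = q (here refl) ∷ map-tgt es (q ∘ there)

  walk-simple : Flow G → ∀ {u v} es → IsWalk G u v es → Unique (walkVertices G u es)
  walk-simple F [] ok = [] ∷ []
  walk-simple F {u} (e ∷ es) (refl , ok) =
    map-tgt (e ∷ es) (λ {f} m eq → acyclic F f
      (subst (λ x → Reach G x (src G f)) eq (walk-head (e ∷ es) (refl , ok) m)))
    ∷ walk-simple F es ok

  through : ∀ {u v} es → IsWalk G u v es → ∀ {x} → x ∈ walkVertices G u es →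
            Reach G u x × Reach G x v
  through es ok (here refl) = ε , listReach es ok
  through (e ∷ es) (refl , ok) (there m) with through es ok m
  ... | p , q = edgeReach e ◅◅ p , q

  TDAG⇒Flow : TDAG G → Flow G
  TDAG⇒Flow ((_ , onPath , _) , acyc) = record
    { acyclic = λ e w → nonempty e w
    ; from-s  = λ v → proj₁ (st v)
    ; to-t    = λ v → proj₂ (st v)
    }
    where
    nonempty : ∀ e → ¬ Reach G (tgt G e) (src G e)
    nonempty e w with toList w
    ... | es , ok , _ with acyc (src G e) (e ∷ es) (refl , ok)
    ... | ()
    st : ∀ v → Reach G (s G) v × Reach G v (t G)
    st v with onPath v
    ... | es , (ok , _) , m = through es ok m

-- Operations

-- Contraction of e identifies the vertex gone with kept; g picks the representatives other than gone,
-- which makes the definition invariant under op.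
record Contraction (G G' : Graph) (e : Edge G) (gone kept : Vertex G) : Set where
  field
    emb      : Edge G' → Edge G
    emb≢e    : ∀ x → emb x ≢ e
    emb-inj  : ∀ {x y} → emb x ≡ emb y → x ≡ y
    emb-sur  : ∀ {x} → x ≢ e → ∃[ x' ] emb x' ≡ x
    f        : Vertex G → Vertex G'
    g        : Vertex G' → Vertex G
    f∘g      : ∀ p → f (g p) ≡ p
    g∘f      : ∀ {v} → v ≢ gone → g (f v) ≡ v
    g∘f-gone : g (f gone) ≡ kept
    src'     : ∀ x → src G' x ≡ f (src G (emb x))
    tgt'     : ∀ x → tgt G' x ≡ f (tgt G (emb x))
    s'       : s G' ≡ f (s G)
    t'       : t G' ≡ f (t G)
    gone≢kept : gone ≢ kept
    ends     : (gone ≡ tgt G e × kept ≡ src G e) ⊎ (gone ≡ src G e × kept ≡ tgt G e)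

  g≢gone : ∀ p → g p ≢ gone
  g≢gone p eq = gone≢kept (trans (sym eq) (trans (cong g (trans (sym (f∘g p)) (cong f eq))) g∘f-gone))

  f-gone : f gone ≡ f kept
  f-gone = trans (sym (f∘g (f gone))) (cong f g∘f-gone)

  f-ends : f (src G e) ≡ f (tgt G e)
  f-ends with ends
  ... | inj₁ (refl , refl) = sym f-gone
  ... | inj₂ (refl , refl) = f-gone

opContraction : ∀ {G G' e z y} → Contraction G G' e z y → Contraction (op G) (op G') e z y
opContraction C = record
  { emb = emb ; emb≢e = emb≢e ; emb-inj = emb-inj ; emb-sur = emb-sur
  ; f = f ; g = g ; f∘g = f∘g ; g∘f = g∘f ; g∘f-gone = g∘f-gone
  ; src' = tgt' ; tgt' = src' ; s' = t' ; t' = s' ; gone≢kept = gone≢kept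
  ; ends = Sum.swap ends }
  where open Contraction C

record Backward (G G' : Graph) : Set where
  field
    contracted  : Edge G
    contraction : Contraction G G' contracted (tgt G contracted) (src G contracted)
    only-in     : ∀ x → tgt G x ≡ tgt G contracted → x ≡ contracted

Forward : Graph → Graph → Set
Forward G G' = Backward (op G) (op G')

module _ {G G' : Graph} (B : Backward G G') where
  open Backward B renaming (contracted to e; contraction to C)
  open Contraction

  -- A vertex differs from its representative only if it is the head of the contracted edge, and
  -- then that edge leads to it from the representative. Both ends have the same image, so the
  -- detour stays in the preimage of `P`.
  settle : ∀ (P : Vertex G' → Set) v → P (f C v) → Walk G (P ∘ f C) (g C (f C v)) v
  settle P v p with v ≟ tgt G e
  ... | yes refl = subst (λ x → Walk G (P ∘ f C) x (tgt G e)) (sym (g∘f-gone C))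
                     (edgeWalk e (subst P (f-gone C) p) p)
  ... | no v≢    = subst (λ x → Walk G (P ∘ f C) x v) (sym (g∘f C v≢)) ε

  -- Only the contracted edge enters the vanishing vertex, so the heads of all other edges are
  -- untouched; a lifted walk needs a detour only in front of the tail of an edge.
  tgt-kept : ∀ x → g C (tgt G' x) ≡ tgt G (emb C x)
  tgt-kept x = trans (cong (g C) (tgt' C x)) (g∘f C (emb≢e C x ∘ only-in (emb C x)))

  lift-src : ∀ (P : Vertex G' → Set) x → P (src G' x) →
             Walk G (P ∘ f C) (g C (src G' x)) (src G (emb C x))
  lift-src P x p rewrite src' C x = settle P (src G (emb C x)) p

  lift-walk : ∀ {P : Vertex G' → Set} {p q} → Walk G' P p q → Walk G (P ∘ f C) (g C p) (g C q)
  lift-walk ε = ε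
  lift-walk {P} (link x refl refl p q ◅ w) =
    lift-src P x p ◅◅
    (link (emb C x) refl (sym (tgt-kept x)) (subst P (src' C x) p)
       (subst P (sym (f∘g C (tgt G' x))) q) ◅ lift-walk w)

  backward-flow : Flow G → Flow G'
  backward-flow F = record { acyclic = acyc ; from-s = fs ; to-t = ts }
    where
    push : ∀ {u v} → Reach G u v → Reach G' (f C u) (f C v)
    push ε = ε
    push {v = v} (link x refl refl _ _ ◅ w) with x ≟ e
    ... | yes refl = subst (λ z → Reach G' z (f C v)) (sym (f-ends C)) (push w)
    ... | no x≢e with emb-sur C x≢e
    ... | x' , refl = link x' (src' C x') (tgt' C x') tt tt ◅ push w
    acyc : ∀ x → ¬ Reach G' (tgt G' x) (src G' x)
    acyc x w = acyclic F (emb C x)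
      (subst (λ v → Reach G v (src G (emb C x))) (tgt-kept x)
        (forget (lift-walk w ◅◅ lift-src (λ _ → ⊤) x tt)))
    fs : ∀ v → Reach G' (s G') v
    fs v = subst₂ (Reach G') (sym (s' C)) (f∘g C v) (push (from-s F (g C v)))
    ts : ∀ v → Reach G' v (t G')
    ts v = subst₂ (Reach G') (f∘g C v) (sym (t' C)) (push (to-t F (g C v)))

-- Degrees and the concrete operations

module Degree (G : Graph) where

  private
    length-1 : ∀ {A : Set} {x y : A} l → length l ≡ 1 → x ∈ l → y ∈ l → x ≡ y
    length-1 (_ ∷ []) _ (here refl) (here refl) = refl

    length-≥2 : ∀ {A : Set} (l : List A) → Unique l → 2 ≤ length l →
                ∃[ x ] ∃[ y ] (x ∈ l × y ∈ l × x ≢ y)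
    length-≥2 (x ∷ y ∷ l) ((x≢y ∷ _) ∷ _) _ = x , y , here refl , there (here refl) , x≢y
    length-≥2 (_ ∷ []) _ (s≤s ())

    inEdges : Vertex G → List (Edge G)
    inEdges v = filter (λ e → tgt G e ≟ v) (allFin (ne G))

    ∈-inEdges : ∀ {e v} → tgt G e ≡ v → e ∈ inEdges v
    ∈-inEdges {e} {v} = ∈-filter⁺ (λ e → tgt G e ≟ v) (∈-allFin e)

    ∈-inEdges⁻ : ∀ {e v} → e ∈ inEdges v → tgt G e ≡ v
    ∈-inEdges⁻ {v = v} m = proj₂ (∈-filter⁻ (λ e → tgt G e ≟ v) {xs = allFin (ne G)} m)

  -- Since `outdeg G` unfolds to `indeg (op G)`, these lemmas serve out-degrees as well.
  indeg-1 : ∀ {v e x} → indeg G v ≡ 1 → tgt G e ≡ v → tgt G x ≡ v → x ≡ e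
  indeg-1 {v} d p q = length-1 (inEdges v) d (∈-inEdges q) (∈-inEdges p)

  indeg-≥2 : ∀ {v} → 2 ≤ indeg G v → ∀ e → ∃[ x ] (x ≢ e × tgt G x ≡ v)
  indeg-≥2 {v} d e with length-≥2 (inEdges v) (filter⁺ (λ e → tgt G e ≟ v) (allFin⁺ (ne G))) d
  ... | x , y , x∈ , y∈ , x≢y with x ≟ e
  ... | no x≢e   = x , x≢e , ∈-inEdges⁻ x∈
  ... | yes refl = y , x≢y ∘ sym , ∈-inEdges⁻ y∈

  indeg-cases : ∀ e → indeg G (tgt G e) ≡ 1 ⊎ 2 ≤ indeg G (tgt G e)
  indeg-cases e = go (inEdges (tgt G e)) (∈-inEdges refl)
    where
    go : ∀ (l : List (Edge G)) → e ∈ l → length l ≡ 1 ⊎ 2 ≤ length l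
    go (_ ∷ []) _ = inj₁ refl
    go (_ ∷ _ ∷ _) _ = inj₂ (s≤s (s≤s z≤n))

module _ {n m : ℕ} (src₀ tgt₀ : Fin (suc m) → Fin (suc n)) (s₀ t₀ : Fin (suc n))
         (e : Fin (suc m)) (ne₀ : src₀ e ≢ tgt₀ e) where

  private
    a b : Fin (suc n)
    a = src₀ e
    b = tgt₀ e
    G : Graph
    G = mkG (suc n) (suc m) src₀ tgt₀ s₀ t₀
    h : Fin (suc n) → Fin n
    h = merge a b ne₀

    g₁ : Fin n → Fin (suc n)
    g₁ = punchIn b

    h∘g₁ : ∀ p → h (g₁ p) ≡ p
    h∘g₁ p with b ≟ punchIn b p
    ... | yes eq = contradiction (sym eq) (punchInᵢ≢i b p)
    ... | no ¬eq = trans (punchOut-cong b refl) (punchOut-punchIn b)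

    g₁∘h : ∀ {v} → v ≢ b → g₁ (h v) ≡ v
    g₁∘h {v} v≢b with b ≟ v
    ... | yes eq = contradiction (sym eq) v≢b
    ... | no b≢v = punchIn-punchOut b≢v

    g₁∘h-b : g₁ (h b) ≡ a
    g₁∘h-b with b ≟ b
    ... | yes _ = punchIn-punchOut _
    ... | no ¬eq = contradiction refl ¬eq

    -- `merge` drops the index of `b`, whichever endpoint is regarded as gone. For a forward
    -- contraction the vanishing vertex is `a`, so the merged vertex has to be represented by `b`.
    g₂ : Fin n → Fin (suc n)
    g₂ p with g₁ p ≟ a
    ... | yes _ = b
    ... | no  _ = g₁ p

    h-ends : h b ≡ h a
    h-ends = trans (sym (h∘g₁ (h b))) (cong h g₁∘h-b)

    h∘g₂ : ∀ p → h (g₂ p) ≡ p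
    h∘g₂ p with g₁ p ≟ a
    ... | yes eq = trans h-ends (trans (cong h (sym eq)) (h∘g₁ p))
    ... | no  _  = h∘g₁ p

    g₂∘h : ∀ {v} → v ≢ a → g₂ (h v) ≡ v
    g₂∘h {v} v≢a with g₁ (h v) ≟ a | v ≟ b
    ... | yes _  | yes v≡b = sym v≡b
    ... | yes eq | no v≢b  = contradiction (trans (sym (g₁∘h v≢b)) eq) v≢a
    ... | no ¬eq | yes refl = contradiction g₁∘h-b ¬eq
    ... | no _   | no v≢b  = g₁∘h v≢b

    g₂∘h-a : g₂ (h a) ≡ b
    g₂∘h-a with g₁ (h a) ≟ a
    ... | yes _  = refl
    ... | no ¬eq = contradiction (g₁∘h ne₀) ¬eq

    emb-sur₀ : ∀ {x} → x ≢ e → ∃[ x' ] punchIn e x' ≡ x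
    emb-sur₀ x≢e = punchOut (x≢e ∘ sym) , punchIn-punchOut (x≢e ∘ sym)

  contract-tgt : Contraction G (contract src₀ tgt₀ s₀ t₀ e ne₀) e b a
  contract-tgt = record
    { emb = punchIn e ; emb≢e = punchInᵢ≢i e ; emb-inj = punchIn-injective e _ _
    ; emb-sur = emb-sur₀ ; f = h ; g = g₁ ; f∘g = h∘g₁ ; g∘f = g₁∘h ; g∘f-gone = g₁∘h-b
    ; src' = λ _ → refl ; tgt' = λ _ → refl ; s' = refl ; t' = refl
    ; gone≢kept = ne₀ ∘ sym ; ends = inj₁ (refl , refl) }

  contract-src : Contraction G (contract src₀ tgt₀ s₀ t₀ e ne₀) e a b
  contract-src = record
    { emb = punchIn e ; emb≢e = punchInᵢ≢i e ; emb-inj = punchIn-injective e _ _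
    ; emb-sur = emb-sur₀ ; f = h ; g = g₂ ; f∘g = h∘g₂ ; g∘f = g₂∘h ; g∘f-gone = g₂∘h-a
    ; src' = λ _ → refl ; tgt' = λ _ → refl ; s' = refl ; t' = refl
    ; gone≢kept = ne₀ ; ends = inj₂ (refl , refl) }

record Deletion (G G' : Graph) : Set where
  field
    deleted  : Edge G
    emb      : Edge G' → Edge G
    emb-inj  : ∀ {x y} → emb x ≡ emb y → x ≡ y
    emb-sur  : ∀ {x} → x ≢ deleted → ∃[ x' ] emb x' ≡ x
    f        : Vertex G → Vertex G'
    g        : Vertex G' → Vertex G
    f∘g      : ∀ p → f (g p) ≡ p
    g∘f      : ∀ v → g (f v) ≡ v
    src'     : ∀ x → g (src G' x) ≡ src G (emb x)
    tgt'     : ∀ x → g (tgt G' x) ≡ tgt G (emb x)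
    s'       : g (s G') ≡ s G
    t'       : g (t G') ≡ t G
    other-in  : ∃[ x ] (x ≢ deleted × tgt G x ≡ tgt G deleted)
    other-out : ∃[ x ] (x ≢ deleted × src G x ≡ src G deleted)

opDeletion : ∀ {G G'} → Deletion G G' → Deletion (op G) (op G')
opDeletion D = record
  { deleted = deleted ; emb = emb ; emb-inj = emb-inj ; emb-sur = emb-sur
  ; f = f ; g = g ; f∘g = f∘g ; g∘f = g∘f ; src' = tgt' ; tgt' = src' ; s' = t' ; t' = s'
  ; other-in = other-out ; other-out = other-in }
  where open Deletion D

module _ {G G' : Graph} (D : Deletion G G') where
  open Deletion D

  deletion-walk : ∀ {P : Vertex G' → Set} {p q} → Walk G' P p q → Walk G (P ∘ f) (g p) (g q)
  deletion-walk ε = ε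
  deletion-walk {P} (link x refl refl p q ◅ w) =
    link (emb x) (sym (src' x)) (sym (tgt' x)) (subst P (sym (f∘g _)) p) (subst P (sym (f∘g _)) q)
    ◅ deletion-walk w

  -- A walk that uses the deleted edge is restarted at the head of that edge, which another edge `x`
  -- still enters. A walk from the source to the tail of `x` avoids the deleted edge, since
  -- otherwise it would close a cycle through `x`.
  deletion-from-s : Flow G → ∀ v → Reach G' (s G') (f v)
  deletion-from-s F v = subst (λ u → Reach G' u (f v)) s≡ (grow {s G} (from-s F v) ε)
    where
    s≡ : f (s G) ≡ s G'
    s≡ = trans (cong f (sym s')) (f∘g (s G'))
    keep : ∀ x → x ≢ deleted → Reach G' (f (src G x)) (f (tgt G x))
    keep x x≢ with emb-sur x≢
    ... | x' , refl = link x' (trans (sym (f∘g _)) (cong f (src' x')))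
                              (trans (sym (f∘g _)) (cong f (tgt' x'))) tt tt ◅ ε
    away : ∀ {u v} → Reach G u v → Reach G v (tgt G deleted) → v ≢ tgt G deleted → Reach G' (f u) (f v)
    away ε _ _ = ε
    away (link x refl refl _ _ ◅ w) r n with x ≟ deleted
    ... | no x≢ = keep x x≢ ◅◅ away w r n
    ... | yes refl with last-edge r
    ... | inj₁ eq = contradiction eq n
    ... | inj₂ (y , r' , eq) = contradiction
            (subst (λ z → Reach G z (src G y)) (sym eq) (w ◅◅ r')) (acyclic F y)
    head-in : Reach G' (f (s G)) (f (tgt G deleted))
    head-in with other-in
    ... | x , x≢ , eq = away (from-s F (src G x)) (subst (Reach G _) eq (edgeReach x))
                          (λ q → acyclic F x (subst₂ (Reach G) (sym eq) (sym q) ε))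
                        ◅◅ subst (λ z → Reach G' _ (f z)) eq (keep x x≢)
    grow : ∀ {u v} → Reach G u v → Reach G' (f (s G)) (f u) → Reach G' (f (s G)) (f v)
    grow ε r = r
    grow (link x refl refl _ _ ◅ w) r with x ≟ deleted
    ... | no x≢    = grow w (r ◅◅ keep x x≢)
    ... | yes refl = grow w head-in

deletion-flow : ∀ {G G'} → Deletion G G' → Flow G → Flow G'
deletion-flow {G} {G'} D F = record
  { acyclic = λ x w → acyclic F (emb x)
      (subst₂ (Reach G) (tgt' x) (src' x) (forget (deletion-walk D w)))
  ; from-s = λ v → subst (Reach G' (s G')) (f∘g v) (deletion-from-s D F (g v))
  ; to-t = λ v → subst (λ u → Reach G' u (t G')) (f∘g v)
                   (reverse (deletion-from-s (opDeletion D) (opFlow F) (g v)))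
  }
  where open Deletion D

delete-edge : ∀ {n m} (src₀ tgt₀ : Fin (suc m) → Fin n) (s₀ t₀ : Fin n) (e : Fin (suc m)) →
  let G = mkG n (suc m) src₀ tgt₀ s₀ t₀ in
  2 ≤ outdeg G (src₀ e) → 2 ≤ indeg G (tgt₀ e) →
  Deletion G (mkG n m (src₀ ∘ punchIn e) (tgt₀ ∘ punchIn e) s₀ t₀)
delete-edge {n} {m} src₀ tgt₀ s₀ t₀ e o i = record
  { deleted = e ; emb = punchIn e ; emb-inj = punchIn-injective e _ _
  ; emb-sur = λ x≢e → punchOut (x≢e ∘ sym) , punchIn-punchOut (x≢e ∘ sym)
  ; f = id ; g = id ; f∘g = λ _ → refl ; g∘f = λ _ → refl ; src' = λ _ → refl ; tgt' = λ _ → refl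
  ; s' = refl ; t' = refl
  ; other-in = Degree.indeg-≥2 G i e ; other-out = Degree.indeg-≥2 (op G) o e }
  where
  G = mkG n (suc m) src₀ tgt₀ s₀ t₀

data StepView (G G' : Graph) : Set where
  isDeletion : Deletion G G' → StepView G G'
  isBackward : Backward G G' → StepView G G'
  isForward  : Forward G G' → StepView G G'

view : ∀ {G G'} → Step G G' → StepView G G'
view (deletion src tgt s t e o i) = isDeletion (delete-edge src tgt s t e o i)
view (backwardContraction src tgt s t e ne d) = isBackward (record
  { contracted = e ; contraction = contract-tgt src tgt s t e ne
  ; only-in = λ x eq → Degree.indeg-1 (mkG _ _ src tgt s t) d refl eq })
view (forwardContraction src tgt s t e ne d) = isForward (record
  { contracted = e ; contraction = opContraction (contract-src src tgt s t e ne)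
  ; only-in = λ x eq → Degree.indeg-1 (op (mkG _ _ src tgt s t)) d refl eq })

step-flow : ∀ {G G'} → Step G G' → Flow G → Flow G'
step-flow st F with view st
... | isDeletion D = deletion-flow D F
... | isBackward B = backward-flow B F
... | isForward B  = opFlow (backward-flow B (opFlow F))

-- Decidable subsets and closures under edges

module _ {n : ℕ} {P : Fin n → Set} (P? : Decidable P) where

  subsetOf : Subset n
  subsetOf = tabulate (λ x → does (P? x))

  ∈-subsetOf⁺ : ∀ {x} → P x → x Sub.∈ subsetOf
  ∈-subsetOf⁺ {x} p = lookup⇒[]= x subsetOf (trans (lookup∘tabulate _ x) (dec-true (P? x) p))

  ∈-subsetOf⁻ : ∀ {x} → x Sub.∈ subsetOf → P x
  ∈-subsetOf⁻ {x} m with P? x | trans (sym (lookup∘tabulate (λ x → does (P? x)) x)) ([]=⇒lookup m)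
  ... | yes p | _ = p

injection-size : ∀ {k m} (S : Subset m) (r : Fin k → Fin m) →
                 (∀ {i j} → r i ≡ r j → i ≡ j) → (∀ i → r i Sub.∈ S) → k ≤ ∣ S ∣
injection-size {zero} S r inj r∈ = z≤n
injection-size {suc k} S r inj r∈ = ℕ.≤-trans
  (s≤s (injection-size (S Sub.- r zero) (r ∘ suc) (Fin.suc-injective ∘ inj)
    (λ i → x∈p∧x≢y⇒x∈p-y (r∈ (suc i)) (λ eq → contradiction (inj eq) λ ()))))
  (x∈p⇒∣p-x∣<∣p∣ (r∈ zero))

-- Reachability along allowed edges as a finite set, because membership has to be decided and `Star`
-- offers no decision. Leastness takes the form of `induct`, from which walks with any wanted
-- property are extracted.
record Closure (G : Graph) (Base : Vertex G → Set) (Allowed : Edge G → Set) : Set₁ where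
  field
    members : Subset (nv G)
  In : Vertex G → Set
  In v = v Sub.∈ members
  In? : Decidable In
  In? v = v ∈? members
  field
    base   : ∀ {v} → Base v → In v
    closed : ∀ e → Allowed e → In (src G e) → In (tgt G e)
    induct : (Q : Vertex G → Set) → (∀ {v} → Base v → Q v) →
             (∀ e → Allowed e → In (src G e) → Q (src G e) → Q (tgt G e)) → ∀ {v} → In v → Q v

  closed-walk : ∀ {P : Vertex G → Set} → (∀ {e} → P (src G e) → P (tgt G e) → Allowed e) →
                ∀ {u v} → Walk G P u v → In u → In v
  closed-walk al ε i = i
  closed-walk al (link e refl refl p q ◅ w) i = closed-walk al w (closed e (al p q) i)

opaque

  closure : (G : Graph) {Base : Vertex G → Set} → Decidable Base →
            {Allowed : Edge G → Set} → Decidable Allowed → Closure G Base Allowed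
  closure G {Base} Base? {Allowed} Allowed? =
    go (nv G) (subsetOf Base?) (ℕ.m≤m+n _ _) (∈-subsetOf⁺ Base?) (λ Q b s m → b (∈-subsetOf⁻ Base? m))
    where
    Induction : Subset (nv G) → Set₁
    Induction R = (Q : Vertex G → Set) → (∀ {v} → Base v → Q v) →
      (∀ e → Allowed e → src G e Sub.∈ R → Q (src G e) → Q (tgt G e)) → ∀ {v} → v Sub.∈ R → Q v

    go : ∀ fuel (R : Subset (nv G)) → nv G ≤ fuel + ∣ R ∣ → (∀ {v} → Base v → v Sub.∈ R) →
         Induction R → Closure G Base Allowed
    go fuel R bound b ind with Fin.any? (λ e → Allowed? e ×-dec (src G e ∈? R) ×-dec ¬? (tgt G e ∈? R))
    ... | no none = record
      { members = R ; base = b ; induct = ind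
      ; closed = λ e a i → decidable-stable (tgt G e ∈? R) (λ n → none (e , a , i , n)) }
    ... | yes (e , a , i , n) = next fuel bound
      where
      R' : Subset (nv G)
      R' = R ∪ ⁅ tgt G e ⁆
      bigger : suc ∣ R ∣ ≤ ∣ R' ∣
      bigger = p⊂q⇒∣p∣<∣q∣ (x∈p∪q⁺ ∘ inj₁ , tgt G e , x∈p∪q⁺ (inj₂ (x∈⁅x⁆ _)) , n)
      ind' : Induction R'
      ind' Q qb qs {v} m with x∈p∪q⁻ R ⁅ tgt G e ⁆ m
      ... | inj₁ r = ind Q qb (λ x ax ix → qs x ax (x∈p∪q⁺ (inj₁ ix))) r
      ... | inj₂ r with x∈⁅y⁆⇒x≡y (tgt G e) r
      ... | refl = qs e a (x∈p∪q⁺ (inj₁ i))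
                     (ind Q qb (λ x ax ix → qs x ax (x∈p∪q⁺ (inj₁ ix))) i)
      -- `fuel` bounds the number of vertices still missing from `R`. At zero `R` would already
      -- contain every vertex, yet `R'` is larger.
      next : ∀ fuel → nv G ≤ fuel + ∣ R ∣ → Closure G Base Allowed
      next zero bound = contradiction (ℕ.≤-trans bigger (∣p∣≤n R')) (ℕ.≤⇒≯ bound)
      next (suc fuel) bound = go fuel R'
        (ℕ.≤-trans bound (ℕ.≤-trans (ℕ.≤-reflexive (sym (ℕ.+-suc fuel ∣ R ∣))) (ℕ.+-monoʳ-≤ fuel bigger)))
        (x∈p∪q⁺ ∘ inj₁ ∘ b) ind'

module _ {G : Graph} {P : Vertex G → Set} (P? : Decidable P) where

  walk-leaves : ∀ {u v} es → IsWalk G u v es → P u → ¬ P v →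
                Any (λ e → P (src G e) × ¬ P (tgt G e)) es
  walk-leaves [] refl p ¬p = contradiction p ¬p
  walk-leaves (e ∷ es) (refl , ok) p ¬p with P? (tgt G e)
  ... | yes q = there (walk-leaves es ok q ¬p)
  ... | no ¬q = here (p , ¬q)

  walk-enters : ∀ {u v} es → IsWalk G u v es → ¬ P u → P v →
                Any (λ e → ¬ P (src G e) × P (tgt G e)) es
  walk-enters [] refl ¬p p = contradiction p ¬p
  walk-enters (e ∷ es) (refl , ok) ¬p p with P? (tgt G e)
  ... | yes q = here (¬p , q)
  ... | no ¬q = there (walk-enters es ok ¬q p)

-- Serial-parallel sets pulled back along d-minors

-- side is the source side of a cut along which every rung is essential; ≺ is a parameter only so that
-- the structure can be turned around by op.
record Marked (G : Graph) {k : ℕ} (_≺_ : Fin k → Fin k → Set) : Set where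
  field
    side     : Vertex G → Bool
    rung     : Fin k → Edge G
    side-s   : side (s G) ≡ true
    side-t   : side (t G) ≡ false
    side-src : ∀ i → side (src G (rung i)) ≡ true
    side-tgt : ∀ i → side (tgt G (rung i)) ≡ false
    from     : ∀ i → Walk G (λ v → side v ≡ true) (s G) (src G (rung i))
    to       : ∀ i → Walk G (λ v → side v ≡ false) (tgt G (rung i)) (t G)
    linked   : ∀ {i j} → i ≺ j → Reach G (tgt G (rung i)) (src G (rung j))

opMarked : ∀ {G k} {_≺_ : Fin k → Fin k → Set} → Marked G _≺_ → Marked (op G) (flip _≺_)
opMarked M = record
  { side = not ∘ side ; rung = rung ; side-s = cong not side-t ; side-t = cong not side-s
  ; side-src = cong not ∘ side-tgt ; side-tgt = cong not ∘ side-src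
  ; from = λ i → weaken (cong not) (reverse (to i))
  ; to = λ i → weaken (cong not) (reverse (from i))
  ; linked = λ q → reverse (linked q) }
  where open Marked M

backward-marked : ∀ {G G' k} {_≺_ : Fin k → Fin k → Set} → Backward G G' → Flow G →
                  Marked G' _≺_ → Marked G _≺_
backward-marked {G} {G'} B F M = record
  { side = side ∘ f ; rung = emb ∘ rung
  ; side-s = subst T s' side-s ; side-t = subst U t' side-t
  ; side-src = λ i → subst T (src' (rung i)) (side-src i)
  ; side-tgt = λ i → subst U (tgt' (rung i)) (side-tgt i)
  ; from = λ i → subst (λ v → Walk G (T ∘ f) v _) g-s (lift-walk B (from i)) ◅◅ lift-src B T (rung i) (side-src i)
  ; to = λ i → subst (λ v → Walk G (U ∘ f) v _) (tgt-kept B (rung i)) (lift-walk B (to i)) ◅◅ settle-t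
  ; linked = λ {i} {j} q → forget
      (subst (λ v → Walk G (λ _ → ⊤) v _) (tgt-kept B (rung i)) (lift-walk B (linked q))
       ◅◅ lift-src B (λ _ → ⊤) (rung j) tt)
  }
  where
  open Marked M
  open Backward B
  open Contraction contraction
  T U : Vertex G' → Set
  T v = side v ≡ true
  U v = side v ≡ false
  g-s : g (s G') ≡ s G
  g-s = trans (cong g s') (g∘f (λ eq → s-source F contracted (sym eq)))
  -- The source never vanishes, as no edge enters it, but the sink may be the head of the contracted
  -- edge; a walk to the sink then has to end with that edge.
  settle-t : Walk G (U ∘ f) (g (t G')) (t G)
  settle-t = subst (λ v → Walk G (U ∘ f) (g v) (t G)) (sym t') (settle B U (t G) (subst U t' side-t))

deletion-marked : ∀ {G G' k} {_≺_ : Fin k → Fin k → Set} → Deletion G G' →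
                  Marked G' _≺_ → Marked G _≺_
deletion-marked {G} {G'} D M = record
  { side = side ∘ f ; rung = emb ∘ rung
  ; side-s = via s' side-s ; side-t = via t' side-t
  ; side-src = λ i → via (src' (rung i)) (side-src i)
  ; side-tgt = λ i → via (tgt' (rung i)) (side-tgt i)
  ; from = λ i → subst₂ (Walk G _) s' (src' (rung i)) (deletion-walk D (from i))
  ; to = λ i → subst₂ (Walk G _) (tgt' (rung i)) t' (deletion-walk D (to i))
  ; linked = λ {i} {j} q → subst₂ (Reach G) (tgt' (rung i)) (src' (rung j)) (deletion-walk D (linked q))
  }
  where
  open Marked M
  open Deletion D
  via : ∀ {p v b} → g p ≡ v → side p ≡ b → side (f v) ≡ b
  via {p} refl eq = trans (cong side (f∘g p)) eq

iso-marked : ∀ {G H k} {_≺_ : Fin k → Fin k → Set} → Iso G H → Marked H _≺_ → Marked G _≺_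
iso-marked {G} {H} I M = record
  { side = side ∘ f ; rung = emb ∘ rung
  ; side-s = trans (cong side s-pres) side-s ; side-t = trans (cong side t-pres) side-t
  ; side-src = λ i → via (src' (rung i)) (side-src i)
  ; side-tgt = λ i → via (tgt' (rung i)) (side-tgt i)
  ; from = λ i → subst₂ (Walk G _) gs (src' (rung i)) (pull (from i))
  ; to = λ i → subst₂ (Walk G _) (tgt' (rung i)) gt (pull (to i))
  ; linked = λ {i} {j} q → subst₂ (Reach G) (tgt' (rung i)) (src' (rung j)) (pull (linked q))
  }
  where
  open Marked M
  open Iso I
  f : Vertex G → Vertex H
  f = Inverse.to vmap
  g : Vertex H → Vertex G
  g = Inverse.from vmap
  emb : Edge H → Edge G
  emb = Inverse.from emap
  f∘g : ∀ p → f (g p) ≡ p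
  f∘g p = Inverse.strictlyInverseˡ vmap p
  g∘f : ∀ p → g (f p) ≡ p
  g∘f p = Inverse.strictlyInverseʳ vmap p
  src' : ∀ x → g (src H x) ≡ src G (emb x)
  src' x = trans (cong g (trans (cong (src H) (sym (Inverse.strictlyInverseˡ emap x))) (src-pres (emb x)))) (g∘f _)
  tgt' : ∀ x → g (tgt H x) ≡ tgt G (emb x)
  tgt' x = trans (cong g (trans (cong (tgt H) (sym (Inverse.strictlyInverseˡ emap x))) (tgt-pres (emb x)))) (g∘f _)
  gs : g (s H) ≡ s G
  gs = trans (cong g (sym s-pres)) (g∘f _)
  gt : g (t H) ≡ t G
  gt = trans (cong g (sym t-pres)) (g∘f _)
  via : ∀ {p v b} → g p ≡ v → side p ≡ b → side (f v) ≡ b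
  via {p} refl eq = trans (cong side (f∘g p)) eq
  pull : ∀ {P : Vertex H → Set} {p q} → Walk H P p q → Walk G (P ∘ f) (g p) (g q)
  pull ε = ε
  pull {P} (link x refl refl p q ◅ w) =
    link (emb x) (sym (src' x)) (sym (tgt' x)) (subst P (sym (f∘g _)) p) (subst P (sym (f∘g _)) q) ◅ pull w

step-marked : ∀ {G G' k} {_≺_ : Fin k → Fin k → Set} → Step G G' → Flow G →
              Marked G' _≺_ → Marked G _≺_
step-marked st F M with view st
... | isDeletion D = deletion-marked D M
... | isBackward B = backward-marked B F M
... | isForward B  = opMarked (backward-marked B (opFlow F) (opMarked M))

minor-marked : ∀ {G H k} {_≺_ : Fin k → Fin k → Set} → DMinor H G → Flow G →
               Marked H _≺_ → Marked G _≺_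
minor-marked {_≺_ = _≺_} (_ , sts , I) F M = go sts F
  where
  go : ∀ {G} → Star Step G _ → Flow G → Marked G _≺_
  go ε F = iso-marked I M
  go (st ◅ sts) F = step-marked st F (go sts (step-flow st F))

chain : ∀ {G n} (r : Fin (suc n) → Edge G) {v : Vertex G} →
        (∀ i → Reach G (tgt G (r (inject₁ i))) (src G (r (suc i)))) →
        Reach G (tgt G (r (fromℕ n))) v →
        ∃[ es ] (IsWalk G (src G (r zero)) v es × (∀ i → r i ∈ es))
chain {G} {zero} r l w with toList w
... | es , ok , _ = r zero ∷ es , (refl , ok) , λ { zero → here refl }
chain {G} {suc n} r l w with toList (l zero) | chain {G} {n} (r ∘ suc) (l ∘ suc) w
... | es , ok , _ | fs , ok' , all = r zero ∷ es ++ fs , (refl , walk-++ es fs ok ok') ,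
  λ { zero → here refl ; (suc i) → there (∈-++⁺ʳ es (all i)) }

marked-spw : ∀ {G n} → Flow G → Marked G {suc n} _<_ → SPW≥ G (suc n)
marked-spw {G} {n} F M = S , serial , (cutSet , (isCut , minimal) , S⊆C) ,
  injection-size S rung distinct (λ i → ∈-subsetOf⁺ S? (i , refl))
  where
  open Marked M
  S? : Decidable (λ e → ∃[ i ] rung i ≡ e)
  S? e = Fin.any? (λ i → rung i ≟ e)
  S : Subset (ne G)
  S = subsetOf S?

  distinct : ∀ {i j} → rung i ≡ rung j → i ≡ j
  distinct {i} {j} eq with Fin.<-cmp i j
  ... | tri≈ _ e _ = e
  ... | tri< l _ _ = contradiction (subst (λ x → Reach G (tgt G (rung i)) (src G x)) (sym eq) (linked l)) (acyclic F (rung i))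
  ... | tri> _ _ l = contradiction (subst (λ x → Reach G (tgt G (rung j)) (src G x)) eq (linked l)) (acyclic F (rung j))

  serial : Serial G S
  serial with toList (from zero)
            | chain rung (λ i → linked (ℕ.≤-reflexive (cong suc (Fin.toℕ-inject₁ i)))) (forget (to (fromℕ n)))
  ... | es , ok , _ | fs , ok' , all = es ++ fs , (walk , walk-simple F (es ++ fs) walk) , covers
    where
    walk : IsWalk G (s G) (t G) (es ++ fs)
    walk = walk-++ es fs ok ok'
    covers : ∀ e → e Sub.∈ S → e ∈ es ++ fs
    covers e m with ∈-subsetOf⁻ S? m
    ... | i , refl = ∈-++⁺ʳ es (all i)

  reachable : Closure G (_≡ s G) (λ e → side (tgt G e) ≡ true)
  reachable = closure G (_≟ s G) (λ e → side (tgt G e) Bool.≟ true)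
  module R = Closure reachable

  -- The edges leaving `R` need not form a minimal cut, since some of them may lead only back to
  -- `R`. Growing `B` from the sink outside `R` and taking the edges that enter `B` leaves out such
  -- edges.
  coreachable : Closure (op G) (_≡ t G) (λ e → ¬ R.In (src G e))
  coreachable = closure (op G) (_≟ t G) (λ e → ¬? (R.In? (src G e)))
  module B = Closure coreachable

  R-side : ∀ {v} → R.In v → side v ≡ true
  R-side = R.induct _ (λ { refl → side-s }) (λ e a _ _ → a)

  ¬R : ∀ {v} → side v ≡ false → ¬ R.In v
  ¬R eq r with trans (sym eq) (R-side r)
  ... | ()

  disjoint : ∀ {v} → B.In v → ¬ R.In v
  disjoint = B.induct _ (λ { refl → ¬R side-t }) (λ e a _ _ → a)

  R-walk : ∀ {v} → R.In v → Walk G (¬_ ∘ B.In) (s G) v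
  R-walk = R.induct (Walk G (¬_ ∘ B.In) (s G)) (λ { refl → ε })
    (λ e a i w → w ◅◅ edgeWalk {G} e (λ b → disjoint b i) (λ b → disjoint b (R.closed e a i)))

  B-walk : ∀ {v} → B.In v → Walk G B.In v (t G)
  B-walk = B.induct (λ v → Walk G B.In v (t G)) (λ { refl → ε }) (λ e a i w → edgeWalk {G} e (B.closed e a i) i ◅◅ w)

  Cut? : Decidable (λ e → ¬ B.In (src G e) × B.In (tgt G e))
  Cut? e = ¬? (B.In? (src G e)) ×-dec B.In? (tgt G e)
  cutSet : Subset (ne G)
  cutSet = subsetOf Cut?

  isCut : IsCut G cutSet
  isCut es (ok , _) = Any.map (∈-subsetOf⁺ Cut?)
    (walk-enters B.In? es ok (λ b → disjoint b (R.base refl)) (B.base refl))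

  minimal : ∀ C' → C' Sub.⊂ cutSet → ¬ IsCut G C'
  minimal C' (C'⊆ , e , e∈ , e∉) cut with ∈-subsetOf⁻ Cut? e∈
  ... | src∉B , tgt∈B
    -- The tail of a cut edge lies in `R`, for otherwise the edge would draw its tail into `B`. A
    -- walk to it outside `B`, the edge, and a walk inside `B` form a path that meets the cut in
    -- this edge alone.
    with toList (R-walk (decidable-stable (R.In? (src G e)) (λ r → src∉B (B.closed e r tgt∈B))))
       | toList (B-walk tgt∈B)
  ... | es , ok , ps | fs , ok' , qs = All.lookupWith (λ n i → n i) avoid
          (cut (es ++ e ∷ fs) (walk , walk-simple F (es ++ e ∷ fs) walk))
    where
    walk : IsWalk G (s G) (t G) (es ++ e ∷ fs)
    walk = walk-++ es (e ∷ fs) ok (refl , ok')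
    avoid : All (λ x → ¬ x Sub.∈ C') (es ++ e ∷ fs)
    avoid = All-++⁺ (All.map (λ p m → proj₂ p (proj₂ (∈-subsetOf⁻ Cut? (C'⊆ m)))) ps)
              (e∉ ∷ All.map (λ q m → proj₁ (∈-subsetOf⁻ Cut? (C'⊆ m)) (proj₁ q)) qs)

  S⊆C : S ⊆ cutSet
  S⊆C {e} m with ∈-subsetOf⁻ S? m
  ... | i , refl = ∈-subsetOf⁺ Cut? ((λ b → disjoint b src∈R) , tgt∈B)
    where
    src∈R : R.In (src G (rung i))
    src∈R = R.closed-walk (λ _ q → q) (from i) (R.base refl)
    tgt∈B : B.In (tgt G (rung i))
    tgt∈B = B.closed-walk (λ p q → ¬R q) (reverse (to i)) (B.base refl)

-- Variants of the graphs SP(k)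

-- `SPVariant` identifies edges with positions in a concatenated list. This bijection lets them be
-- addressed by their role instead.
record Enumerates {A B : Set} (xs : List B) (val : A → B) : Set where
  field
    index        : A → Fin (length xs)
    decode       : Fin (length xs) → A
    index-decode : ∀ i → index (decode i) ≡ i
    decode-index : ∀ a → decode (index a) ≡ a
    lookup-index : ∀ a → lookup xs (index a) ≡ val a

open Enumerates

enum-tabulate : ∀ {n} {A B : Set} (f : A → B) (g : Fin n → A) →
                Enumerates (map f (List.tabulate g)) (f ∘ g)
enum-tabulate {zero} f g = record
  { index = id ; decode = id ; index-decode = λ () ; decode-index = λ () ; lookup-index = λ () }
enum-tabulate {suc n} f g = record
  { index = λ { zero → zero ; (suc i) → suc (index E i) }
  ; decode = λ { zero → zero ; (suc i) → suc (decode E i) }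
  ; index-decode = λ { zero → refl ; (suc i) → cong suc (index-decode E i) }
  ; decode-index = λ { zero → refl ; (suc i) → cong suc (decode-index E i) }
  ; lookup-index = λ { zero → refl ; (suc i) → lookup-index E i } }
  where
  E : Enumerates (map f (List.tabulate (g ∘ suc))) (f ∘ g ∘ suc)
  E = enum-tabulate f (g ∘ suc)

enum-++ : ∀ {A A' B : Set} {xs ys : List B} {val : A → B} {val' : A' → B} →
  Enumerates xs val → Enumerates ys val' → Enumerates (xs ++ ys) [ val , val' ]′
enum-++ {xs = xs} {ys} {val} {val'} E F = record
  { index = [ left xs ∘ index E , right xs ∘ index F ]′
  ; decode = λ i → back (split xs i)
  ; index-decode = λ i → trans (ix-back (split xs i)) (join-split xs i)
  ; decode-index = λ { (inj₁ a) → trans (cong back (split-left xs (index E a))) (cong inj₁ (decode-index E a))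
                     ; (inj₂ a) → trans (cong back (split-right xs (index F a))) (cong inj₂ (decode-index F a)) }
  ; lookup-index = λ { (inj₁ a) → trans (lookup-left xs (index E a)) (lookup-index E a)
                     ; (inj₂ a) → trans (lookup-right xs (index F a)) (lookup-index F a) } }
  where
  left : ∀ xs → Fin (length xs) → Fin (length (xs ++ ys))
  left (x ∷ xs) zero = zero
  left (x ∷ xs) (suc i) = suc (left xs i)
  right : ∀ xs → Fin (length ys) → Fin (length (xs ++ ys))
  right [] i = i
  right (x ∷ xs) i = suc (right xs i)
  bump : ∀ {m k} → Fin m ⊎ Fin k → Fin (suc m) ⊎ Fin k
  bump (inj₁ i) = inj₁ (suc i)
  bump (inj₂ i) = inj₂ i
  split : ∀ xs → Fin (length (xs ++ ys)) → Fin (length xs) ⊎ Fin (length ys)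
  split [] i = inj₂ i
  split (x ∷ xs) zero = inj₁ zero
  split (x ∷ xs) (suc i) = bump (split xs i)
  join : ∀ xs → Fin (length xs) ⊎ Fin (length ys) → Fin (length (xs ++ ys))
  join xs = [ left xs , right xs ]′
  join-split : ∀ xs i → join xs (split xs i) ≡ i
  join-split [] i = refl
  join-split (x ∷ xs) zero = refl
  join-split (x ∷ xs) (suc i) with split xs i | join-split xs i
  ... | inj₁ _ | eq = cong suc eq
  ... | inj₂ _ | eq = cong suc eq
  split-left : ∀ xs i → split xs (left xs i) ≡ inj₁ i
  split-left (x ∷ xs) zero = refl
  split-left (x ∷ xs) (suc i) = cong bump (split-left xs i)
  split-right : ∀ xs i → split xs (right xs i) ≡ inj₂ i
  split-right [] i = refl
  split-right (x ∷ xs) i = cong bump (split-right xs i)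
  lookup-left : ∀ xs i → lookup (xs ++ ys) (left xs i) ≡ lookup xs i
  lookup-left (x ∷ xs) zero = refl
  lookup-left (x ∷ xs) (suc i) = lookup-left xs i
  lookup-right : ∀ xs i → lookup (xs ++ ys) (right xs i) ≡ lookup ys i
  lookup-right [] i = refl
  lookup-right (x ∷ xs) i = lookup-right xs i
  back : Fin (length xs) ⊎ Fin (length ys) → _ ⊎ _
  back (inj₁ i) = inj₁ (decode E i)
  back (inj₂ i) = inj₂ (decode F i)
  ix-back : ∀ z → [ left xs ∘ index E , right xs ∘ index F ]′ (back z) ≡ join xs z
  ix-back (inj₁ i) = cong (left xs) (index-decode E i)
  ix-back (inj₂ i) = cong (right xs) (index-decode F i)

pattern treeA i = inj₁ i
pattern treeB i = inj₂ (inj₁ i)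
pattern cross i = inj₂ (inj₂ (inj₁ i))
pattern back i  = inj₂ (inj₂ (inj₂ i))

module Variant (n : ℕ) (pa pb : Fin n → Fin (suc n)) where

  H : Graph
  H = SPVariant n pa pb

  EdgeName : Set
  EdgeName = Fin n ⊎ (Fin n ⊎ (Fin (suc n) ⊎ Fin n))

  a b : Fin (suc n) → Vertex H
  a i = i ↑ˡ suc n
  b i = suc n ↑ʳ i

  source target : EdgeName → Vertex H
  source (treeA i) = a (pa i)
  source (treeB i) = b (inject₁ i)
  source (cross i) = a i
  source (back i)  = b (inject₁ i)
  target (treeA i) = a (suc i)
  target (treeB i) = b (pb i)
  target (cross i) = b i
  target (back i)  = a (suc i)

  private
    enumeration = enum-++ (enum-tabulate (λ i → a (pa i) , a (suc i)) id)
          (enum-++ (enum-tabulate (λ i → b (inject₁ i) , b (pb i)) id)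
            (enum-++ (enum-tabulate (λ i → a i , b i) id)
              (enum-tabulate (λ i → b (inject₁ i) , a (suc i)) id)))

  opaque
    name : EdgeName → Edge H
    name = index enumeration

    unname : Edge H → EdgeName
    unname = decode enumeration

    name-unname : ∀ e → name (unname e) ≡ e
    name-unname = index-decode enumeration

    unname-name : ∀ e → unname (name e) ≡ e
    unname-name = decode-index enumeration

    src-name : ∀ e → src H (name e) ≡ source e
    src-name x@(treeA i) = cong proj₁ (lookup-index enumeration x)
    src-name x@(treeB i) = cong proj₁ (lookup-index enumeration x)
    src-name x@(cross i) = cong proj₁ (lookup-index enumeration x)
    src-name x@(back i)  = cong proj₁ (lookup-index enumeration x)

    tgt-name : ∀ e → tgt H (name e) ≡ target e
    tgt-name x@(treeA i) = cong proj₂ (lookup-index enumeration x)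
    tgt-name x@(treeB i) = cong proj₂ (lookup-index enumeration x)
    tgt-name x@(cross i) = cong proj₂ (lookup-index enumeration x)
    tgt-name x@(back i)  = cong proj₂ (lookup-index enumeration x)

  isA : Vertex H → Bool
  isA v = [ const true , const false ]′ (splitAt (suc n) v)

  isA-a : ∀ i → isA (a i) ≡ true
  isA-a i rewrite Fin.splitAt-↑ˡ (suc n) i (suc n) = refl

  isA-b : ∀ i → isA (b i) ≡ false
  isA-b i rewrite Fin.splitAt-↑ʳ (suc n) (suc n) i = refl

  named-edge : ∀ {P : Vertex H → Set} e → P (source e) → P (target e) → Walk H P (source e) (target e)
  named-edge e p q = link (name e) (src-name e) (tgt-name e) p q ◅ ε

  variant-marked : ValidVariant n pa pb → Marked H {suc n} _<_
  variant-marked (pa≤ , pb>) = record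
    { side = isA ; rung = λ i → name (cross i)
    ; side-s = isA-a zero ; side-t = isA-b (fromℕ n)
    ; side-src = λ i → trans (cong isA (src-name (cross i))) (isA-a i)
    ; side-tgt = λ i → trans (cong isA (tgt-name (cross i))) (isA-b i)
    ; from = λ i → subst (Walk H _ (a zero)) (sym (src-name (cross i))) (fromA (toℕ i) i ℕ.≤-refl)
    ; to = λ i → subst (λ v → Walk H _ v (b (fromℕ n))) (sym (tgt-name (cross i))) (toB n i (ℕ.m≤m+n n (toℕ i)))
    ; linked = λ {i} {j} i<j → subst₂ (Reach H) (sym (tgt-name (cross i))) (sym (src-name (cross j)))
                                (climb (toℕ j) i j ℕ.≤-refl i<j)
    }
    where
    -- The parent has a smaller index without being a subterm, so the recursion runs on a bound for
    -- the index.
    fromA : ∀ fuel i → toℕ i ≤ fuel → Walk H (λ v → isA v ≡ true) (a zero) (a i)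
    fromA fuel zero _ = ε
    fromA (suc fuel) (suc i) (s≤s le) =
      fromA fuel (pa i) (ℕ.≤-trans (pa≤ i) le) ◅◅ named-edge (treeA i) (isA-a (pa i)) (isA-a (suc i))

    -- Here `fuel` bounds the distance to the last index, which shrinks because `pb i` exceeds `i`.
    toB : ∀ fuel i → n ≤ fuel + toℕ i → Walk H (λ v → isA v ≡ false) (b i) (b (fromℕ n))
    toB fuel i le with topView i
    ... | ‵fromℕ = ε
    toB zero _ le | ‵inject₁ i = contradiction (subst (n ≤_) (Fin.toℕ-inject₁ i) le) (ℕ.<⇒≱ (Fin.toℕ<n i))
    toB (suc fuel) _ le | ‵inject₁ i =
      named-edge (treeB i) (isA-b (inject₁ i)) (isA-b (pb i)) ◅◅
      toB fuel (pb i) (ℕ.≤-trans le (ℕ.≤-trans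
        (ℕ.≤-reflexive (trans (sym (ℕ.+-suc fuel _)) (cong (λ m → fuel + suc m) (Fin.toℕ-inject₁ i))))
        (ℕ.+-monoʳ-≤ fuel (pb> i))))

    climb : ∀ fuel i j → toℕ j ≤ fuel → i < j → Reach H (b i) (a j)
    climb (suc fuel) i (suc j) (s≤s le) (s≤s i≤j) with i ≟ inject₁ j
    ... | yes refl = named-edge (back j) tt tt
    ... | no  i≢j  = climb fuel i (inject₁ j) (subst (_≤ fuel) (sym (Fin.toℕ-inject₁ j)) le)
                       (ℕ.≤∧≢⇒< (subst (toℕ i ≤_) (sym (Fin.toℕ-inject₁ j)) i≤j) (i≢j ∘ Fin.toℕ-injective))
                     ◅◅ named-edge (cross (inject₁ j)) tt tt ◅◅ named-edge (back j) tt tt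

variant-minor⇒SPW : ∀ {G k} → Flow G → SomeSPVariantDMinor k G → SPW≥ G k
variant-minor⇒SPW F (n , refl , pa , pb , valid , minor) =
  marked-spw F (minor-marked minor F (Variant.variant-marked n pa pb valid))

-- Contraction models

data Kind : Set where
  junk cen out inn : Kind

-- Within a fibre everything flows through the centre: edges of the target graph may arrive at the
-- centre or in the in-tree before it, and may depart from the centre or from the out-tree behind
-- it. Vertices of kind `junk` belong to no fibre.
Exit Entry : Kind → Set
Exit junk = ⊥
Exit cen  = ⊤
Exit out  = ⊤
Exit inn  = ⊥
Entry junk = ⊥
Entry cen  = ⊤
Entry out  = ⊥
Entry inn  = ⊤

exit≢junk : ∀ {k} → Exit k → k ≢ junk
exit≢junk () refl

entry≢junk : ∀ {k} → Entry k → k ≢ junk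
entry≢junk () refl

junk? : ∀ k → Dec (k ≡ junk)
junk? junk = yes refl
junk? cen  = no λ ()
junk? out  = no λ ()
junk? inn  = no λ ()

data Label (A : Set) : Set where
  extra tree : Label A
  real : A → Label A

extra? : ∀ {A} (l : Label A) → Dec (l ≡ extra)
extra? extra    = yes refl
extra? tree     = no λ ()
extra? (real _) = no λ ()

tree? : ∀ {A} (l : Label A) → Dec (l ≡ tree)
tree? extra    = no λ ()
tree? tree     = yes refl
tree? (real _) = no λ ()

-- The kept edges (label ≢ extra) form a subgraph of G that contracts to H.  The fibre of φ over
-- a vertex of H is an in-tree (kind inn) to its centre followed by an out-tree (kind out), so each
-- tree edge stays contractible once the other edges have been removed.
record Model (G H : Graph) : Set where
  field
    kind : Vertex G → Kind
    φ    : Vertex G → Vertex H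
    lab  : Edge G → Label (Edge H)

  Kept : Edge G → Set
  Kept e = lab e ≢ extra

  field
    real-src  : ∀ {e h} → lab e ≡ real h → φ (src G e) ≡ src H h × Exit (kind (src G e))
    real-tgt  : ∀ {e h} → lab e ≡ real h → φ (tgt G e) ≡ tgt H h × Entry (kind (tgt G e))
    tree-φ    : ∀ {e} → lab e ≡ tree → φ (src G e) ≡ φ (tgt G e)
    tree-kind : ∀ {e} → lab e ≡ tree → (Exit (kind (src G e)) × kind (tgt G e) ≡ out)
                                     ⊎ (kind (src G e) ≡ inn × Entry (kind (tgt G e)))
    real-sur  : ∀ h → ∃[ e ] lab e ≡ real h
    real-inj  : ∀ {e e' h} → lab e ≡ real h → lab e' ≡ real h → e ≡ e'
    cen-sur   : ∀ h → ∃[ v ] (kind v ≡ cen × φ v ≡ h)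
    cen-inj   : ∀ {v v'} → kind v ≡ cen → kind v' ≡ cen → φ v ≡ φ v' → v ≡ v'
    cen-s     : kind (s G) ≡ cen
    cen-t     : kind (t G) ≡ cen
    φ-s       : φ (s G) ≡ s H
    φ-t       : φ (t G) ≡ t H
    out-uniq  : ∀ {v e e'} → kind v ≡ out → Kept e → tgt G e ≡ v → Kept e' → tgt G e' ≡ v → e ≡ e'
    inn-uniq  : ∀ {v e e'} → kind v ≡ inn → Kept e → src G e ≡ v → Kept e' → src G e' ≡ v → e ≡ e'
    has-in    : ∀ {v} → kind v ≢ junk → v ≢ s G → ∃[ e ] (Kept e × tgt G e ≡ v)
    has-out   : ∀ {v} → kind v ≢ junk → v ≢ t G → ∃[ e ] (Kept e × src G e ≡ v)

  kept-src : ∀ {e} → Kept e → kind (src G e) ≢ junk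
  kept-src {e} k with lab e in eq
  ... | extra = contradiction refl k
  ... | real h = exit≢junk (proj₂ (real-src eq))
  ... | tree with tree-kind eq
  ... | inj₁ (x , _) = exit≢junk x
  ... | inj₂ (x , _) = λ y → contradiction (trans (sym x) y) λ ()

  kept-tgt : ∀ {e} → Kept e → kind (tgt G e) ≢ junk
  kept-tgt {e} k with lab e in eq
  ... | extra = contradiction refl k
  ... | real h = entry≢junk (proj₂ (real-tgt eq))
  ... | tree with tree-kind eq
  ... | inj₁ (_ , x) = λ y → contradiction (trans (sym x) y) λ ()
  ... | inj₂ (_ , x) = entry≢junk x

-- Models under deletion and contraction

module _ {G G' H : Graph} (D : Deletion G G') (M : Model G H) where
  open Deletion D
  open Model M

  deletion-model : lab deleted ≡ extra → Model G' H
  deletion-model junked = record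
    { kind = kind ∘ g ; φ = φ ∘ g ; lab = lab ∘ emb
    ; real-src = λ {x} l → subst (λ v → φ v ≡ _ × Exit (kind v)) (sym (src' x)) (real-src l)
    ; real-tgt = λ {x} l → subst (λ v → φ v ≡ _ × Entry (kind v)) (sym (tgt' x)) (real-tgt l)
    ; tree-φ = λ {x} l → subst₂ (λ u v → φ u ≡ φ v) (sym (src' x)) (sym (tgt' x)) (tree-φ l)
    ; tree-kind = λ {x} l → subst₂ (λ u v → (Exit (kind u) × kind v ≡ out) ⊎ (kind u ≡ inn × Entry (kind v)))
                              (sym (src' x)) (sym (tgt' x)) (tree-kind l)
    ; real-sur = λ h → let (e , l) = real-sur h
                           (x , eq) = emb-sur (λ q → contradiction (trans (sym l) (trans (cong lab q) junked)) λ ())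
                       in x , trans (cong lab eq) l
    ; real-inj = λ l l' → emb-inj (real-inj l l')
    ; cen-sur = λ h → let (v , c , p) = cen-sur h
                      in f v , trans (cong kind (g∘f v)) c , trans (cong φ (g∘f v)) p
    ; cen-inj = λ c c' p → g-inj (cen-inj c c' p)
    ; cen-s = trans (cong kind s') cen-s ; cen-t = trans (cong kind t') cen-t
    ; φ-s = trans (cong φ s') φ-s ; φ-t = trans (cong φ t') φ-t
    ; out-uniq = λ {v} {x} {y} k kx px ky py → emb-inj (out-uniq k kx (trans (sym (tgt' x)) (cong g px))
                                                                  ky (trans (sym (tgt' y)) (cong g py)))
    ; inn-uniq = λ {v} {x} {y} k kx px ky py → emb-inj (inn-uniq k kx (trans (sym (src' x)) (cong g px))
                                                                  ky (trans (sym (src' y)) (cong g py)))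
    ; has-in = λ {v} k n → let (e , ke , pe) = has-in k (λ q → n (g-inj (trans q (sym s'))))
                               (x , eq) = emb-sur (λ q → ke (trans (cong lab q) junked))
                           in x , (λ q → ke (trans (cong lab (sym eq)) q))
                                , g-inj (trans (tgt' x) (trans (cong (tgt G) eq) pe))
    ; has-out = λ {v} k n → let (e , ke , pe) = has-out k (λ q → n (g-inj (trans q (sym t'))))
                                (x , eq) = emb-sur (λ q → ke (trans (cong lab q) junked))
                            in x , (λ q → ke (trans (cong lab (sym eq)) q))
                                 , g-inj (trans (src' x) (trans (cong (src G) eq) pe))
    }
    where
    g-inj : ∀ {p q} → g p ≡ g q → p ≡ q
    g-inj {p} {q} eq = trans (sym (f∘g p)) (trans (cong f eq) (f∘g q))

-- A common interface for three situations: a junk vertex merged into a neighbour, an out-tree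
-- vertex into its parent, an in-tree vertex into its successor. `out-into` and `inn-from` keep a
-- merged tree vertex from acquiring a second kept edge on its restricted side; `in-kept` and
-- `out-kept` say that the merged vertex does not lose its last kept edge, which it may inherit from
-- `gone`.
record Absorbs {G H : Graph} (M : Model G H) (e : Edge G) (gone kept : Vertex G) : Set where
  open Model M
  field
    not-real : ∀ {h} → lab e ≢ real h
    not-cen  : kind gone ≢ cen
    exit     : Exit (kind gone) → Exit (kind kept)
    entry    : Entry (kind gone) → Entry (kind kept)
    fibre    : kind gone ≢ junk → φ kept ≡ φ gone
    out-into : kind gone ≡ out ⊎ kind kept ≡ out → ∀ {x} → Kept x → tgt G x ≡ gone → x ≡ e
    inn-from : kind gone ≡ inn ⊎ kind kept ≡ inn → ∀ {x} → Kept x → src G x ≡ gone → x ≡ e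
    in-kept  : kind kept ≢ junk → kept ≢ s G →
               ∃[ x ] (Kept x × x ≢ e × (tgt G x ≡ kept ⊎ tgt G x ≡ gone))
    out-kept : kind kept ≢ junk → kept ≢ t G →
               ∃[ x ] (Kept x × x ≢ e × (src G x ≡ kept ⊎ src G x ≡ gone))

module _ {G G' H : Graph} {e : Edge G} {gone kept : Vertex G} (C : Contraction G G' e gone kept)
         (M : Model G H) (A : Absorbs M e gone kept) where
  open Contraction C
  open Model M
  open Absorbs A

  private
    r : Vertex G → Vertex G
    r v = g (f v)

    r-exit : ∀ v → Exit (kind v) → Exit (kind (r v))
    r-exit v x with v ≟ gone
    ... | yes refl = subst (Exit ∘ kind) (sym g∘f-gone) (exit x)
    ... | no n     = subst (Exit ∘ kind) (sym (g∘f n)) x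

    r-entry : ∀ v → Entry (kind v) → Entry (kind (r v))
    r-entry v x with v ≟ gone
    ... | yes refl = subst (Entry ∘ kind) (sym g∘f-gone) (entry x)
    ... | no n     = subst (Entry ∘ kind) (sym (g∘f n)) x

    r-φ : ∀ v → kind v ≢ junk → φ (r v) ≡ φ v
    r-φ v x with v ≟ gone
    ... | yes refl = trans (cong φ g∘f-gone) (fibre x)
    ... | no n     = cong φ (g∘f n)

    r-out : ∀ x → Kept (emb x) → kind (tgt G (emb x)) ≡ out → kind (r (tgt G (emb x))) ≡ out
    r-out x k o with tgt G (emb x) ≟ gone
    ... | yes eq = contradiction (out-into (inj₁ (trans (cong kind (sym eq)) o)) k eq) (emb≢e x)
    ... | no n   = trans (cong kind (g∘f n)) o

    r-inn : ∀ x → Kept (emb x) → kind (src G (emb x)) ≡ inn → kind (r (src G (emb x))) ≡ inn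
    r-inn x k o with src G (emb x) ≟ gone
    ... | yes eq = contradiction (inn-from (inj₁ (trans (cong kind (sym eq)) o)) k eq) (emb≢e x)
    ... | no n   = trans (cong kind (g∘f n)) o

    at-tgt : ∀ {p} x → kind (g p) ≡ out → Kept (emb x) → tgt G' x ≡ p → tgt G (emb x) ≡ g p
    at-tgt x o k refl with tgt G (emb x) ≟ gone
    ... | no n = sym (trans (cong g (tgt' x)) (g∘f n))
    ... | yes eq = contradiction (out-into (inj₂ (trans (cong kind (sym g-p)) o)) k eq) (emb≢e x)
      where
      g-p : g (tgt G' x) ≡ kept
      g-p = trans (cong g (trans (tgt' x) (cong f eq))) g∘f-gone

    at-src : ∀ {p} x → kind (g p) ≡ inn → Kept (emb x) → src G' x ≡ p → src G (emb x) ≡ g p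
    at-src x o k refl with src G (emb x) ≟ gone
    ... | no n = sym (trans (cong g (src' x)) (g∘f n))
    ... | yes eq = contradiction (inn-from (inj₂ (trans (cong kind (sym g-p)) o)) k eq) (emb≢e x)
      where
      g-p : g (src G' x) ≡ kept
      g-p = trans (cong g (trans (src' x) (cong f eq))) g∘f-gone

    g-inj : ∀ {p q} → g p ≡ g q → p ≡ q
    g-inj {p} {q} eq = trans (sym (f∘g p)) (trans (cong f eq) (f∘g q))

    fix-cen : ∀ {v} → kind v ≡ cen → r v ≡ v
    fix-cen c = g∘f (λ eq → not-cen (trans (cong kind (sym eq)) c))

    ends-apart : ∀ {v} → v ≢ gone → v ≢ kept → src G e ≢ v × tgt G e ≢ v
    ends-apart n k with ends
    ... | inj₁ (p , q) = (λ eq → k (sym (trans q eq))) , (λ eq → n (sym (trans p eq)))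
    ... | inj₂ (p , q) = (λ eq → n (sym (trans p eq))) , (λ eq → k (sym (trans q eq)))

    pull-in : ∀ {p x} → Kept x → x ≢ e → f (tgt G x) ≡ p → ∃[ y ] (Kept (emb y) × tgt G' y ≡ p)
    pull-in k n eq with emb-sur n
    ... | y , refl = y , k , trans (tgt' y) eq

    pull-out : ∀ {p x} → Kept x → x ≢ e → f (src G x) ≡ p → ∃[ y ] (Kept (emb y) × src G' y ≡ p)
    pull-out k n eq with emb-sur n
    ... | y , refl = y , k , trans (src' y) eq

    f-merge : ∀ {u p} → g p ≡ kept → u ≡ kept ⊎ u ≡ gone → f u ≡ p
    f-merge {p = p} eq (inj₁ refl) = trans (cong f (sym eq)) (f∘g p)
    f-merge {p = p} eq (inj₂ refl) = trans f-gone (trans (cong f (sym eq)) (f∘g p))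

    in-edge : ∀ {p} → kind (g p) ≢ junk → p ≢ s G' → ∃[ y ] (Kept (emb y) × tgt G' y ≡ p)
    in-edge {p} k p≢s with g p ≟ kept
    ... | yes eq =
      let (x , kx , x≢e , at) = in-kept (k ∘ trans (cong kind eq))
            (λ q → p≢s (trans (sym (f∘g p)) (trans (cong f (trans eq q)) (sym s'))))
      in pull-in kx x≢e (f-merge eq at)
    ... | no n =
      let (x , kx , at) = has-in k (λ q → p≢s (trans (sym (f∘g p)) (trans (cong f q) (sym s'))))
      in pull-in kx (λ q → proj₂ (ends-apart (g≢gone p) n) (trans (cong (tgt G) (sym q)) at)) (trans (cong f at) (f∘g p))

    out-edge : ∀ {p} → kind (g p) ≢ junk → p ≢ t G' → ∃[ y ] (Kept (emb y) × src G' y ≡ p)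
    out-edge {p} k p≢t with g p ≟ kept
    ... | yes eq =
      let (x , kx , x≢e , at) = out-kept (k ∘ trans (cong kind eq))
            (λ q → p≢t (trans (sym (f∘g p)) (trans (cong f (trans eq q)) (sym t'))))
      in pull-out kx x≢e (f-merge eq at)
    ... | no n =
      let (x , kx , at) = has-out k (λ q → p≢t (trans (sym (f∘g p)) (trans (cong f q) (sym t'))))
      in pull-out kx (λ q → proj₁ (ends-apart (g≢gone p) n) (trans (cong (src G) (sym q)) at)) (trans (cong f at) (f∘g p))

  -- The old model read off at the representatives. Neither a centre nor a real edge disappears, so
  -- the correspondence with `H` survives.
  contraction-model : Model G' H
  contraction-model = record
    { kind = kind ∘ g ; φ = φ ∘ g ; lab = lab ∘ emb
    ; real-src = λ {x} l → let (p , q) = real-src l in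
        trans (cong (φ ∘ g) (src' x)) (trans (r-φ _ (exit≢junk q)) p) ,
        subst (Exit ∘ kind ∘ g) (sym (src' x)) (r-exit _ q)
    ; real-tgt = λ {x} l → let (p , q) = real-tgt l in
        trans (cong (φ ∘ g) (tgt' x)) (trans (r-φ _ (entry≢junk q)) p) ,
        subst (Entry ∘ kind ∘ g) (sym (tgt' x)) (r-entry _ q)
    ; tree-φ = λ {x} l → subst₂ (λ u v → φ (g u) ≡ φ (g v)) (sym (src' x)) (sym (tgt' x))
        (trans (r-φ _ (kept-src (tree-kept x l))) (trans (tree-φ l) (sym (r-φ _ (kept-tgt (tree-kept x l))))))
    ; tree-kind = λ {x} l → subst₂
        (λ u v → (Exit (kind (g u)) × kind (g v) ≡ out) ⊎ (kind (g u) ≡ inn × Entry (kind (g v))))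
        (sym (src' x)) (sym (tgt' x)) (tk x l (tree-kind l))
    ; real-sur = λ h → let (z , l) = real-sur h
                           (x , eq) = emb-sur (λ q → not-real (trans (cong lab (sym q)) l))
                       in x , trans (cong lab eq) l
    ; real-inj = λ l l' → emb-inj (real-inj l l')
    ; cen-sur = λ h → let (v , c , p) = cen-sur h
                      in f v , trans (cong kind (fix-cen c)) c , trans (cong φ (fix-cen c)) p
    ; cen-inj = λ c c' p → g-inj (cen-inj c c' p)
    ; cen-s = trans (cong kind g-s) cen-s ; cen-t = trans (cong kind g-t) cen-t
    ; φ-s = trans (cong φ g-s) φ-s ; φ-t = trans (cong φ g-t) φ-t
    ; out-uniq = λ {v} {x} {y} o kx px ky py →
        emb-inj (out-uniq o kx (at-tgt x o kx px) ky (at-tgt y o ky py))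
    ; inn-uniq = λ {v} {x} {y} o kx px ky py →
        emb-inj (inn-uniq o kx (at-src x o kx px) ky (at-src y o ky py))
    ; has-in = in-edge
    ; has-out = out-edge
    }
    where
    g-s : g (s G') ≡ s G
    g-s = trans (cong g s') (fix-cen cen-s)
    g-t : g (t G') ≡ t G
    g-t = trans (cong g t') (fix-cen cen-t)
    tree-kept : ∀ x → lab (emb x) ≡ tree → Kept (emb x)
    tree-kept x l q = contradiction (trans (sym l) q) λ ()
    tk : ∀ x → lab (emb x) ≡ tree →
         (Exit (kind (src G (emb x))) × kind (tgt G (emb x)) ≡ out)
         ⊎ (kind (src G (emb x)) ≡ inn × Entry (kind (tgt G (emb x)))) →
         (Exit (kind (r (src G (emb x)))) × kind (r (tgt G (emb x))) ≡ out)
         ⊎ (kind (r (src G (emb x))) ≡ inn × Entry (kind (r (tgt G (emb x)))))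
    tk x l (inj₁ (p , q)) = inj₁ (r-exit _ p , r-out x (tree-kept x l) q)
    tk x l (inj₂ (p , q)) = inj₂ (r-inn x (tree-kept x l) p , r-entry _ q)

module _ {G H : Graph} (M : Model G H) (e : Edge G) where
  open Model M

  absorb-junk : ∀ {gone kept} → lab e ≡ extra → kind gone ≡ junk → Absorbs M e gone kept
  absorb-junk {gone} {kept} l j = record
    { not-real = λ q → contradiction (trans (sym l) q) λ ()
    ; not-cen = λ q → contradiction (trans (sym j) q) λ ()
    ; exit = λ x → contradiction j (exit≢junk x)
    ; entry = λ x → contradiction j (entry≢junk x)
    ; fibre = λ n → contradiction j n
    ; out-into = λ _ k eq → contradiction (trans (cong kind eq) j) (kept-tgt k)
    ; inn-from = λ _ k eq → contradiction (trans (cong kind eq) j) (kept-src k)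
    ; in-kept = λ k n → let (x , kx , eq) = has-in k n in x , kx , (λ q → kx (trans (cong lab q) l)) , inj₁ eq
    ; out-kept = λ k n → let (x , kx , eq) = has-out k n in x , kx , (λ q → kx (trans (cong lab q) l)) , inj₁ eq
    }

  absorb-out : Flow G → lab e ≡ tree → Exit (kind (src G e)) → kind (tgt G e) ≡ out →
               Absorbs M e (tgt G e) (src G e)
  absorb-out F l x o = record
    { not-real = λ q → contradiction (trans (sym l) q) λ ()
    ; not-cen = λ q → contradiction (trans (sym o) q) λ ()
    ; exit = λ _ → x
    ; entry = λ y → ⊥-elim (subst Entry o y)
    ; fibre = λ _ → tree-φ l
    ; out-into = λ _ k eq → out-uniq o k eq ke refl
    ; inn-from = λ { (inj₁ q) → contradiction (trans (sym o) q) λ ()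
                   ; (inj₂ q) → ⊥-elim (subst Exit q x) }
    ; in-kept = λ k n → let (z , kz , eq) = has-in k n
                        in z , kz , (λ q → src≢tgt F e (sym (trans (cong (tgt G) (sym q)) eq))) , inj₁ eq
    -- The contracted edge may have been the only kept edge out of its tail. The edge needed is
    -- inherited from the head, which is not the sink because the sink is a centre.
    ; out-kept = λ _ _ → let (z , kz , eq) = has-out (λ q → contradiction (trans (sym o) q) λ ())
                                               (λ q → contradiction (trans (sym o) (trans (cong kind q) cen-t)) λ ())
                         in z , kz , (λ q → src≢tgt F e (trans (cong (src G) (sym q)) eq)) , inj₂ eq
    }
    where
    ke : Kept e
    ke q = contradiction (trans (sym l) q) λ ()

  absorb-inn : Flow G → lab e ≡ tree → kind (src G e) ≡ inn → Entry (kind (tgt G e)) →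
               Absorbs M e (src G e) (tgt G e)
  absorb-inn F l o x = record
    { not-real = λ q → contradiction (trans (sym l) q) λ ()
    ; not-cen = λ q → contradiction (trans (sym o) q) λ ()
    ; exit = λ y → ⊥-elim (subst Exit o y)
    ; entry = λ _ → x
    ; fibre = λ _ → sym (tree-φ l)
    ; out-into = λ { (inj₁ q) → contradiction (trans (sym o) q) λ ()
                   ; (inj₂ q) → ⊥-elim (subst Entry q x) }
    ; inn-from = λ _ k eq → inn-uniq o k eq ke refl
    ; in-kept = λ _ _ → let (z , kz , eq) = has-in (λ q → contradiction (trans (sym o) q) λ ())
                                              (λ q → contradiction (trans (sym o) (trans (cong kind q) cen-s)) λ ())
                        in z , kz , (λ q → src≢tgt F e (sym (trans (cong (tgt G) (sym q)) eq))) , inj₂ eq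
    ; out-kept = λ k n → let (z , kz , eq) = has-out k n
                         in z , kz , (λ q → src≢tgt F e (trans (cong (src G) (sym q)) eq)) , inj₁ eq
    }
    where
    ke : Kept e
    ke q = contradiction (trans (sym l) q) λ ()

  -- A vertex of the subgraph other than the source is entered by a kept edge, so an extra edge
  -- cannot be the only one entering it; and no edge at all enters the source.
  junk-tgt : Flow G → lab e ≡ extra → (∀ x → tgt G x ≡ tgt G e → x ≡ e) → kind (tgt G e) ≡ junk
  junk-tgt F l only = decidable-stable (junk? (kind (tgt G e))) λ n →
    let (x , kx , at) = has-in n (s-source F e) in kx (trans (cong lab (only x at)) l)

  junk-src : Flow G → lab e ≡ extra → (∀ x → src G x ≡ src G e → x ≡ e) → kind (src G e) ≡ junk
  junk-src F l only = decidable-stable (junk? (kind (src G e))) λ n →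
    let (x , kx , at) = has-out n (t-sink F e) in kx (trans (cong lab (only x at)) l)

-- Once all edges are real, a vertex that is not a terminal is both the head of one and the tail of
-- another, hence both `Entry` and `Exit`. Only centres are both, and centres correspond to the
-- vertices of `H`.
all-real⇒Iso : ∀ {G H} (M : Model G H) → Flow G →
               (∀ e → ∃[ h ] Model.lab M e ≡ real h) → Iso G H
all-real⇒Iso {G} {H} M F label = record
  { vmap = mk↔ₛ′ φ (λ h → proj₁ (cen-sur h)) (λ h → proj₂ (proj₂ (cen-sur h)))
      (λ v → cen-inj (proj₁ (proj₂ (cen-sur (φ v)))) (all-cen v) (proj₂ (proj₂ (cen-sur (φ v)))))
  ; emap = mk↔ₛ′ (λ e → proj₁ (label e)) (λ h → proj₁ (real-sur h))
      (λ h → real-injective (trans (sym (proj₂ (label _))) (proj₂ (real-sur h))))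
      (λ e → real-inj (proj₂ (real-sur _)) (proj₂ (label e)))
  ; src-pres = λ e → sym (proj₁ (real-src (proj₂ (label e))))
  ; tgt-pres = λ e → sym (proj₁ (real-tgt (proj₂ (label e))))
  ; s-pres = φ-s
  ; t-pres = φ-t
  }
  where
  open Model M
  real-injective : ∀ {h h' : Edge H} → real h ≡ real h' → h ≡ h'
  real-injective refl = refl
  tgt-entry : ∀ e → Entry (kind (tgt G e))
  tgt-entry e = proj₂ (real-tgt (proj₂ (label e)))
  src-exit : ∀ e → Exit (kind (src G e))
  src-exit e = proj₂ (real-src (proj₂ (label e)))
  cen-or : ∀ k → (k ≢ cen → Entry k × Exit k) → k ≡ cen
  cen-or cen h = refl
  cen-or junk h = ⊥-elim (proj₁ (h λ ()))
  cen-or out h = ⊥-elim (proj₁ (h λ ()))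
  cen-or inn h = ⊥-elim (proj₂ (h λ ()))
  all-cen : ∀ v → kind v ≡ cen
  all-cen v = cen-or (kind v) λ n →
    let (e , te) = has-in-edge F v (λ q → n (trans (cong kind q) cen-s))
        (x , sx) = has-in-edge (opFlow F) v (λ q → n (trans (cong kind q) cen-t))
    in subst (Entry ∘ kind) te (tgt-entry e) , subst (Exit ∘ kind) sx (src-exit x)

-- Reduction of a graph to the target of its model

Removable : Graph → Graph → Set
Removable G H = ∃[ G' ] (Step G G' × ne G ≡ suc (ne G') × Model G' H)

-- An extra edge either has spare edges at both ends and is deleted, or is alone at one end, which
-- is then junk. Tree edges have to wait: `out-uniq` and `inn-uniq` speak of kept edges, whereas the
-- degree condition of a contraction counts all of them, and `all-kept` makes the two agree.
remove-edge : ∀ {G H} → Flow G → (M : Model G H) → ∀ e → (∀ {h} → Model.lab M e ≢ real h) →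
              (Model.lab M e ≡ tree → ∀ x → Model.Kept M x) → Removable G H
remove-edge {mkG (suc n) (suc m) src₀ tgt₀ s₀ t₀} {H} F M e not-real all-kept
  with Model.lab M e in l | Degree.indeg-cases (op (mkG (suc n) (suc m) src₀ tgt₀ s₀ t₀)) e
     | Degree.indeg-cases (mkG (suc n) (suc m) src₀ tgt₀ s₀ t₀) e
... | real h | _ | _ = contradiction refl not-real
... | extra | inj₁ o | _ = _ , forwardContraction src₀ tgt₀ s₀ t₀ e (src≢tgt F e) o , refl ,
  contraction-model (contract-src src₀ tgt₀ s₀ t₀ e (src≢tgt F e)) M (absorb-junk M e l
    (junk-src M e F l (λ x eq → Degree.indeg-1 (op (mkG _ _ src₀ tgt₀ s₀ t₀)) o refl eq)))
... | extra | inj₂ _ | inj₁ i = _ , backwardContraction src₀ tgt₀ s₀ t₀ e (src≢tgt F e) i , refl ,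
  contraction-model (contract-tgt src₀ tgt₀ s₀ t₀ e (src≢tgt F e)) M (absorb-junk M e l
    (junk-tgt M e F l (λ x eq → Degree.indeg-1 (mkG _ _ src₀ tgt₀ s₀ t₀) i refl eq)))
... | extra | inj₂ o | inj₂ i = _ , deletion src₀ tgt₀ s₀ t₀ e o i , refl ,
  deletion-model (delete-edge src₀ tgt₀ s₀ t₀ e o i) M l
... | tree | degO | degI with Model.tree-kind M l
... | inj₁ (x , o) = backward degI
  where
  backward : let G = mkG (suc n) (suc m) src₀ tgt₀ s₀ t₀ in
             indeg G (tgt₀ e) ≡ 1 ⊎ 2 ≤ indeg G (tgt₀ e) → Removable G H
  backward (inj₁ i) = _ , backwardContraction src₀ tgt₀ s₀ t₀ e (src≢tgt F e) i , refl ,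
    contraction-model (contract-tgt src₀ tgt₀ s₀ t₀ e (src≢tgt F e)) M (absorb-out M e F l x o)
  backward (inj₂ i) = let (z , z≢e , eq) = Degree.indeg-≥2 (mkG _ _ src₀ tgt₀ s₀ t₀) i e in
    contradiction (Model.out-uniq M o (all-kept refl z) eq (all-kept refl e) refl) z≢e
... | inj₂ (o , x) = forward degO
  where
  forward : let G = mkG (suc n) (suc m) src₀ tgt₀ s₀ t₀ in
            outdeg G (src₀ e) ≡ 1 ⊎ 2 ≤ outdeg G (src₀ e) → Removable G H
  forward (inj₁ i) = _ , forwardContraction src₀ tgt₀ s₀ t₀ e (src≢tgt F e) i , refl ,
    contraction-model (contract-src src₀ tgt₀ s₀ t₀ e (src≢tgt F e)) M (absorb-inn M e F l o x)
  forward (inj₂ i) = let (z , z≢e , eq) = Degree.indeg-≥2 (op (mkG _ _ src₀ tgt₀ s₀ t₀)) i e in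
    contradiction (Model.inn-uniq M o (all-kept refl z) eq (all-kept refl e) refl) z≢e
remove-edge {mkG zero (suc m) src₀ _ _ _} F M e = contradiction (src₀ e) λ ()

-- Every operation lowers the number of edges by exactly one, so `m` serves as the measure.
model⇒minor   : ∀ m {G H} → ne G ≡ m → Flow G → Model G H → DMinor H G
after-removal : ∀ m {G H} → ne G ≡ m → Flow G → Removable G H → DMinor H G

after-removal zero size F (_ , _ , eq , _) = contradiction (trans (sym eq) size) λ ()
after-removal (suc m) size F (_ , st , eq , M)
  with model⇒minor m (ℕ.suc-injective (trans (sym eq) size)) (step-flow st F) M
... | K , sts , iso = K , st ◅ sts , iso

model⇒minor m {G} {H} size F M with Fin.any? (λ e → extra? (Model.lab M e)) | Fin.any? (λ e → tree? (Model.lab M e))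
... | no ne | no nt = G , ε , all-real⇒Iso M F label
  where
  label : ∀ e → ∃[ h ] Model.lab M e ≡ real h
  label e with Model.lab M e in l
  ... | extra = contradiction (e , l) ne
  ... | tree = contradiction (e , l) nt
  ... | real h = h , refl
... | yes (e , l) | _ = after-removal m size F (remove-edge F M e (λ q → contradiction (trans (sym l) q) λ ())
                                       (λ q → contradiction (trans (sym l) q) λ ()))
... | no ne | yes (e , l) = after-removal m size F (remove-edge F M e (λ q → contradiction (trans (sym l) q) λ ())
                                           (λ _ x q → ne (x , q)))

-- Trees on one side of a cut

module _ {G : Graph} {P : Vertex G → Set} where

  Inside : List (Edge G) → Set
  Inside = All (λ e → P (src G e) × P (tgt G e))

  walk-head-inside : ∀ {u v} es → IsWalk G u v es → Inside es → ∀ {e} → e ∈ es → Walk G P u (src G e)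
  walk-head-inside (e ∷ es) (refl , ok) ps (here refl) = ε
  walk-head-inside (e ∷ es) (refl , ok) ((p , q) ∷ ps) (there m) =
    edgeWalk {G} e p q ◅◅ walk-head-inside es ok ps m

  walk-linear : ∀ {u v} es → IsWalk G u v es → Inside es → ∀ {e e'} → e ∈ es → e' ∈ es →
                e ≡ e' ⊎ Walk G P (tgt G e) (src G e') ⊎ Walk G P (tgt G e') (src G e)
  walk-linear (e ∷ es) (refl , ok) (p ∷ ps) (here refl) (here refl) = inj₁ refl
  walk-linear (e ∷ es) (refl , ok) (p ∷ ps) (here refl) (there m) = inj₂ (inj₁ (walk-head-inside es ok ps m))
  walk-linear (e ∷ es) (refl , ok) (p ∷ ps) (there m) (here refl) = inj₂ (inj₂ (walk-head-inside es ok ps m))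
  walk-linear (e ∷ es) (refl , ok) (p ∷ ps) (there m) (there m') = walk-linear es ok ps m m'

module _ {G : Graph} where

  walk-first : ∀ {u v} es → IsWalk G u v es → u ≡ v ⊎ ∃[ e ] (e ∈ es × src G e ≡ u)
  walk-first [] refl = inj₁ refl
  walk-first (e ∷ es) (eq , _) = inj₂ (e , here refl , eq)

  walk-last : ∀ {u v} es → IsWalk G u v es → u ≡ v ⊎ ∃[ e ] (e ∈ es × tgt G e ≡ v)
  walk-last [] refl = inj₁ refl
  walk-last (e ∷ es) (refl , ok) with walk-last es ok
  ... | inj₁ eq = inj₂ (e , here refl , eq)
  ... | inj₂ (x , m , eq) = inj₂ (x , there m , eq)

  walk-prev : ∀ {u v} es → IsWalk G u v es → ∀ {e} → e ∈ es →
              src G e ≡ u ⊎ ∃[ x ] (x ∈ es × tgt G x ≡ src G e)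
  walk-prev (e ∷ es) (refl , ok) (here refl) = inj₁ refl
  walk-prev (e ∷ es) (refl , ok) (there m) with walk-prev es ok m
  ... | inj₁ eq = inj₂ (e , here refl , sym eq)
  ... | inj₂ (x , m' , eq) = inj₂ (x , there m' , eq)

  walk-next : ∀ {u v} es → IsWalk G u v es → ∀ {e} → e ∈ es →
              tgt G e ≡ v ⊎ ∃[ x ] (x ∈ es × src G x ≡ tgt G e)
  walk-next (e ∷ es) (refl , ok) (here refl) with walk-first es ok
  ... | inj₁ eq = inj₁ eq
  ... | inj₂ (x , m , eq) = inj₂ (x , there m , eq)
  walk-next (e ∷ es) (refl , ok) (there m) with walk-next es ok m
  ... | inj₁ eq = inj₁ eq
  ... | inj₂ (x , m' , eq) = inj₂ (x , there m' , eq)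

AcyclicReach : Graph → Set
AcyclicReach G = ∀ e → ¬ Reach G (tgt G e) (src G e)

module _ {G : Graph} (acyc : AcyclicReach G) where

  _⊏_ : Vertex G → Vertex G → Set
  u ⊏ v = ∃[ e ] (Reach G u (src G e) × tgt G e ≡ v)

  -- By acyclicity, reachability along at least one edge is a strict order, and a strict order on a
  -- finite set is well-founded. This justifies climbing from parent to parent.
  ⊏-wellFounded : WellFounded _⊏_
  ⊏-wellFounded = spo-wellFounded record
    { isEquivalence = isEquivalence
    ; irrefl = λ { refl (e , w , refl) → acyc e w }
    ; trans = λ { (e , w , refl) (e' , w' , eq) → e' , w ◅◅ edgeReach e ◅◅ w' , eq }
    ; <-resp-≈ = resp₂ _⊏_ }

-- One side of the cut: walks y i → σ i, pairwise disjoint, all of whose ends σ i are reachable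
-- from the start y i₀ of one of them; ρ enumerates the indices other than i₀.
record Side (G : Graph) (X : Vertex G → Set) {n : ℕ} (ρ : Fin n → Fin (suc n)) (i₀ : Fin (suc n))
            (y σ : Fin (suc n) → Vertex G) : Set where
  field
    ρ≢i₀     : ∀ j → ρ j ≢ i₀
    ρ-inj    : ∀ {j j'} → ρ j ≡ ρ j' → j ≡ j'
    ρ-cover  : ∀ i → i ≢ i₀ → ∃[ j ] ρ j ≡ i
    y∈X      : ∀ i → X (y i)
    segment  : ∀ i → Walk G X (y i) (σ i)
    root-to  : ∀ i → Walk G X (y i₀) (σ i)
    disjoint : ∀ {i j v} → Reach G (y i) v → Reach G v (σ i) → Reach G (y j) v → Reach G v (σ j) → i ≡ j

-- The counterpart of `Model` for one side, with a tree on the indices as target: `real j` stands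
-- for the tree edge from `par j` to `ρ j`. The starts `y (ρ j)` may lack an edge in and the ends
-- `σ i` an edge out; the edges between the two sides will supply them. `par-reach` and `par≢` later
-- determine the direction of the tree edges.
record SideModel (G : Graph) (X : Vertex G → Set) {n : ℕ} (ρ : Fin n → Fin (suc n)) (i₀ : Fin (suc n))
                 (y σ : Fin (suc n) → Vertex G) : Set where
  field
    kind : Vertex G → Kind
    φ    : Vertex G → Fin (suc n)
    lab  : Edge G → Label (Fin n)
    par  : Fin n → Fin (suc n)

  Kept : Edge G → Set
  Kept e = lab e ≢ extra

  field
    in-X      : ∀ {v} → kind v ≢ junk → X v
    real-src  : ∀ {e j} → lab e ≡ real j → φ (src G e) ≡ par j × Exit (kind (src G e))
    real-tgt  : ∀ {e j} → lab e ≡ real j → φ (tgt G e) ≡ ρ j × Entry (kind (tgt G e))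
    tree-φ    : ∀ {e} → lab e ≡ tree → φ (src G e) ≡ φ (tgt G e)
    tree-kind : ∀ {e} → lab e ≡ tree → (Exit (kind (src G e)) × kind (tgt G e) ≡ out)
                                     ⊎ (kind (src G e) ≡ inn × Entry (kind (tgt G e)))
    real-sur  : ∀ j → ∃[ e ] lab e ≡ real j
    real-inj  : ∀ {e e' j} → lab e ≡ real j → lab e' ≡ real j → e ≡ e'
    cen-sur   : ∀ i → ∃[ v ] (kind v ≡ cen × φ v ≡ i)
    cen-inj   : ∀ {v v'} → kind v ≡ cen → kind v' ≡ cen → φ v ≡ φ v' → v ≡ v'
    cen-root  : kind (y i₀) ≡ cen
    out-uniq  : ∀ {v e e'} → kind v ≡ out → Kept e → tgt G e ≡ v → Kept e' → tgt G e' ≡ v → e ≡ e'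
    inn-uniq  : ∀ {v e e'} → kind v ≡ inn → Kept e → src G e ≡ v → Kept e' → src G e' ≡ v → e ≡ e'
    has-in    : ∀ {v} → kind v ≢ junk → v ≢ y i₀ → (∃[ e ] (Kept e × tgt G e ≡ v)) ⊎ ∃[ j ] v ≡ y (ρ j)
    has-out   : ∀ {v} → kind v ≢ junk → (∃[ e ] (Kept e × src G e ≡ v)) ⊎ ∃[ i ] v ≡ σ i
    y-entry   : ∀ i → Entry (kind (y i))
    y-φ       : ∀ i → φ (y i) ≡ i
    σ-exit    : ∀ i → Exit (kind (σ i))
    σ-φ       : ∀ i → φ (σ i) ≡ i
    par-reach : ∀ j → Reach G (y (par j)) (σ (ρ j))
    par≢      : ∀ j → par j ≢ ρ j

module BuildSide {G : Graph} (acyc : AcyclicReach G) {X : Vertex G → Set} (X? : Decidable X)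
                 {n : ℕ} {ρ : Fin n → Fin (suc n)} {i₀ : Fin (suc n)} {y σ : Fin (suc n) → Vertex G}
                 (side : Side G X ρ i₀ y σ) where
  open Side side

  private
    s₀ : Vertex G
    s₀ = y i₀

    opaque
      qs : Fin (suc n) → List (Edge G)
      qs i = proj₁ (toList (segment i))

      qs-walk : ∀ i → IsWalk G (y i) (σ i) (qs i)
      qs-walk i = proj₁ (proj₂ (toList (segment i)))

      qs-inside : ∀ i → Inside {G} {X} (qs i)
      qs-inside i = proj₂ (proj₂ (toList (segment i)))

    OnE : Edge G → Set
    OnE e = ∃[ i ] e ∈ qs i

    opaque
      OnE? : Decidable OnE
      OnE? e = Fin.any? (λ i → Any.any? (e ≟_) (qs i))

    OnAt : Fin (suc n) → Vertex G → Set
    OnAt i v = v ≡ y i ⊎ ∃[ e ] (e ∈ qs i × tgt G e ≡ v)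

    On : Vertex G → Set
    On v = ∃[ i ] OnAt i v

    opaque
      On? : Decidable On
      On? v = Fin.any? (λ i → (v ≟ y i) ⊎-dec Fin.any? (λ e → Any.any? (e ≟_) (qs i) ×-dec (tgt G e ≟ v)))

    on-tgt : ∀ {i e} → e ∈ qs i → OnAt i (tgt G e)
    on-tgt m = inj₂ (_ , m , refl)

    on-src : ∀ {i e} → e ∈ qs i → OnAt i (src G e)
    on-src {i} m = walk-prev (qs i) (qs-walk i) m

    on-next : ∀ {i v} → OnAt i v → v ≡ σ i ⊎ ∃[ e ] (e ∈ qs i × src G e ≡ v)
    on-next {i} (inj₁ refl) = walk-first (qs i) (qs-walk i)
    on-next {i} (inj₂ (e , m , refl)) = walk-next (qs i) (qs-walk i) m

    on-σ : ∀ i → OnAt i (σ i)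
    on-σ i with walk-last (qs i) (qs-walk i)
    ... | inj₁ eq = inj₁ (sym eq)
    ... | inj₂ x  = inj₂ x

    on-from : ∀ {i v} → OnAt i v → Reach G (y i) v
    on-from (inj₁ refl) = ε
    on-from {i} (inj₂ (e , m , refl)) = walk-head (qs i) (qs-walk i) m ◅◅ edgeReach e

    on-to : ∀ {i v} → OnAt i v → Reach G v (σ i)
    on-to {i} (inj₁ refl) = listReach (qs i) (qs-walk i)
    on-to {i} (inj₂ (e , m , refl)) = walk-tail (qs i) (qs-walk i) m

    on-unique : ∀ {i j v} → OnAt i v → OnAt j v → i ≡ j
    on-unique o o' = disjoint (on-from o) (on-to o) (on-from o') (on-to o')

    on-X : ∀ {i v} → OnAt i v → X v
    on-X (inj₁ refl) = y∈X _
    on-X {i} (inj₂ (e , m , refl)) = proj₂ (All.lookup (qs-inside i) m)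

    -- Disjointness puts both edges on one segment, and two different edges of one walk with a
    -- common head would close a cycle.
    tgt-unique : ∀ {e e'} → OnE e → OnE e' → tgt G e ≡ tgt G e' → e ≡ e'
    tgt-unique {e} {e'} (i , m) (j , m') eq with on-unique (on-tgt m) (subst (OnAt j) (sym eq) (on-tgt m'))
    ... | refl with walk-linear {G} {X} (qs i) (qs-walk i) (qs-inside i) m m'
    ... | inj₁ p = p
    ... | inj₂ (inj₁ w) = contradiction (subst (λ v → Reach G v (src G e')) eq (forget w)) (acyc e')
    ... | inj₂ (inj₂ w) = contradiction (subst (λ v → Reach G v (src G e)) (sym eq) (forget w)) (acyc e)

    src-unique : ∀ {e e'} → OnE e → OnE e' → src G e ≡ src G e' → e ≡ e'
    src-unique {e} {e'} (i , m) (j , m') eq with on-unique (on-src m) (subst (OnAt j) (sym eq) (on-src m'))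
    ... | refl with walk-linear {G} {X} (qs i) (qs-walk i) (qs-inside i) m m'
    ... | inj₁ p = p
    ... | inj₂ (inj₁ w) = contradiction (subst (Reach G (tgt G e)) (sym eq) (forget w)) (acyc e)
    ... | inj₂ (inj₂ w) = contradiction (subst (Reach G (tgt G e')) eq (forget w)) (acyc e')

    reachable : Closure G (_≡ s₀) (λ e → X (tgt G e))
    reachable = closure G (_≟ s₀) (X? ∘ tgt G)
    module R = Closure reachable

    R-X : ∀ {v} → R.In v → X v
    R-X = R.induct X (λ { refl → y∈X i₀ }) (λ _ x _ _ → x)

    R-reach : ∀ {v} → R.In v → Reach G s₀ v
    R-reach = R.induct (Reach G s₀) (λ { refl → ε }) (λ e _ _ w → w ◅◅ edgeReach e)

    R-walk : ∀ {u v} → Walk G X u v → R.In u → R.In v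
    R-walk = R.closed-walk (λ _ q → q)

    R-σ : ∀ i → R.In (σ i)
    R-σ i = R-walk (root-to i) (R.base refl)

    Good : Edge G → Set
    Good e = R.In (src G e) × R.In (tgt G e)

    opaque
      Good? : Decidable Good
      Good? e = R.In? (src G e) ×-dec R.In? (tgt G e)

    on-good : ∀ {e} → OnE e → R.In (src G e) → Good e
    on-good {e} (i , m) r = r , R.closed e (proj₂ (All.lookup (qs-inside i) m)) r

    not-into-root : ∀ {e} → R.In (src G e) → tgt G e ≢ s₀
    not-into-root {e} r eq = acyc e (subst (λ v → Reach G v (src G e)) (sym eq) (R-reach r))

    PathInto : Vertex G → Set
    PathInto v = ∃[ e ] (Good e × OnE e × tgt G e ≡ v)

    opaque
      PathInto? : Decidable PathInto
      PathInto? v = Fin.any? (λ e → Good? e ×-dec OnE? e ×-dec (tgt G e ≟ v))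

    opaque
      GoodInto? : ∀ v → Dec (∃[ e ] (Good e × tgt G e ≡ v))
      GoodInto? v = Fin.any? (λ e → Good? e ×-dec (tgt G e ≟ v))

    -- Path edges are preferred, so that the tree contains the final, reachable part of every segment.
    parent : Vertex G → Maybe (Edge G)
    parent v with PathInto? v | GoodInto? v
    ... | yes (e , _) | _           = just e
    ... | no _        | yes (e , _) = just e
    ... | no _        | no _        = nothing

    parent-good : ∀ {v e} → parent v ≡ just e → Good e × tgt G e ≡ v
    parent-good {v} eq with PathInto? v | GoodInto? v
    parent-good refl | yes (e , g , _ , p) | _ = g , p
    parent-good refl | no _ | yes (e , g , p) = g , p

    parent-on : ∀ {v} → (p : PathInto v) → parent v ≡ just (proj₁ p)
    parent-on {v} (e , g , o , eq) with PathInto? v | GoodInto? v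
    ... | yes (e' , _ , o' , eq') | _ = cong just (tgt-unique o' o (trans eq' (sym eq)))
    ... | no n | _ = contradiction (e , g , o , eq) n

    parent-exists : ∀ {v} → R.In v → v ≢ s₀ → ∃[ e ] parent v ≡ just e
    parent-exists {v} r v≢ with PathInto? v | GoodInto? v
    ... | yes (e , _) | _ = e , refl
    ... | no _ | yes (e , _) = e , refl
    ... | no _ | no n with R.induct (λ v → v ≡ s₀ ⊎ ∃[ e ] (Good e × tgt G e ≡ v)) inj₁
                            (λ e x i _ → inj₂ (e , (i , R.closed e x i) , refl)) r
    ... | inj₁ eq = contradiction eq v≢
    ... | inj₂ g  = contradiction g n

    opaque
      IsParent? : Decidable (λ e → parent (tgt G e) ≡ just e)
      IsParent? e = Maybe.≡-dec _≟_ (parent (tgt G e)) (just e)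

    -- Only the ancestors of the segments are kept, so that no leaf of the tree is a dead end.
    useful : Closure (op G) (λ v → R.In v × On v) (λ e → parent (tgt G e) ≡ just e)
    useful = closure (op G) (λ v → R.In? v ×-dec On? v) IsParent?
    module U = Closure useful

    U-R : ∀ {v} → U.In v → R.In v
    U-R = U.induct R.In proj₁ (λ e p _ _ → proj₁ (proj₁ (parent-good p)))

    TreeEdge : Edge G → Set
    TreeEdge e = U.In (tgt G e) × parent (tgt G e) ≡ just e

    opaque
      TreeEdge? : Decidable TreeEdge
      TreeEdge? e = U.In? (tgt G e) ×-dec IsParent? e

    treeEdge-src : ∀ {e} → TreeEdge e → U.In (src G e)
    treeEdge-src {e} (u , p) = U.closed e p u

    U-out : ∀ {v} → U.In v → On v ⊎ ∃[ e ] (TreeEdge e × src G e ≡ v)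
    U-out = U.induct (λ v → On v ⊎ ∃[ e ] (TreeEdge e × src G e ≡ v)) (inj₁ ∘ proj₂)
              (λ e p u _ → inj₂ (e , (u , p) , refl))

    parent-edge : ∀ {v} → U.In v → v ≢ s₀ → ∃[ e ] (TreeEdge e × tgt G e ≡ v)
    parent-edge u v≢ with parent-exists (U-R u) v≢
    ... | e , p with proj₂ (parent-good p)
    ... | refl = e , (u , p) , refl

    on-treeEdge : ∀ {e} → OnE e → R.In (src G e) → TreeEdge e
    on-treeEdge {e} o@(i , m) r = U.base (proj₂ (on-good o r) , i , on-tgt m) , parent-on (e , on-good o r , o , refl)

    -- For vertices of `R` this singles out the point where a segment enters `R`, which becomes the
    -- centre of the fibre. Outside `R` it holds for every vertex of a segment and carries no
    -- information, so it is always combined with `U`.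
    Top : Vertex G → Set
    Top v = On v × ¬ PathInto v

    opaque
      Top? : Decidable Top
      Top? v = On? v ×-dec ¬? (PathInto? v)

    root-top : Top s₀
    root-top = (i₀ , inj₁ refl) , λ { (e , (r , _) , _ , eq) → not-into-root r eq }

    U-root : U.In s₀
    U-root = U.base (R.base refl , i₀ , inj₁ refl)

    -- The index of the first segment met when climbing along parents, as a relation: the function
    -- found by well-founded recursion is opaque, and its equations come from `ancestor-unique`. The
    -- index `i₀` in `none` is a default for vertices outside `R`, since in `R` only the root can
    -- lack a parent and the root lies on a segment.
    data Ancestor : Vertex G → Fin (suc n) → Set where
      on   : ∀ {v i} → OnAt i v → Ancestor v i
      up   : ∀ {v e i} → ¬ On v → parent v ≡ just e → Ancestor (src G e) i → Ancestor v i
      none : ∀ {v} → ¬ On v → parent v ≡ nothing → Ancestor v i₀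

    ancestor-unique : ∀ {v i j} → Ancestor v i → Ancestor v j → i ≡ j
    ancestor-unique (on o) (on o') = on-unique o o'
    ancestor-unique (on o) (up n _ _) = contradiction (_ , o) n
    ancestor-unique (on o) (none n _) = contradiction (_ , o) n
    ancestor-unique (up n _ _) (on o) = contradiction (_ , o) n
    ancestor-unique (up _ p a) (up _ p' a') with trans (sym p) p'
    ... | refl = ancestor-unique a a'
    ancestor-unique (up _ p _) (none _ p') = contradiction (trans (sym p) p') λ ()
    ancestor-unique (none n _) (on o) = contradiction (_ , o) n
    ancestor-unique (none _ p) (up _ p' _) = contradiction (trans (sym p) p') λ ()
    ancestor-unique (none _ _) (none _ _) = refl

    parent-⊏ : ∀ {v e} → parent v ≡ just e → _⊏_ acyc (src G e) v
    parent-⊏ {v} {e} p = e , ε , proj₂ (parent-good p)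

    opaque
      ancestor : ∀ v → ∃[ i ] Ancestor v i
      ancestor v = go v (⊏-wellFounded acyc v)
        where
        go : ∀ v → Acc (_⊏_ acyc) v → ∃[ i ] Ancestor v i
        go v (acc rec) with On? v | parent v in eq
        ... | yes (i , o) | _ = i , on o
        ... | no n | nothing = i₀ , none n eq
        ... | no n | just e with go (src G e) (rec (parent-⊏ eq))
        ... | i , a = i , up n eq a

    φ₀ : Vertex G → Fin (suc n)
    φ₀ v = proj₁ (ancestor v)

    φ-on : ∀ {i v} → OnAt i v → φ₀ v ≡ i
    φ-on {v = v} o = ancestor-unique (proj₂ (ancestor v)) (on o)

    -- Off the segments this is how ancestors are defined. On a segment, a vertex that is not a top
    -- is entered by a reachable path edge; path edges are preferred as parents, so the parent stays
    -- on the segment.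
    φ-parent : ∀ {v e} → ¬ Top v → parent v ≡ just e → φ₀ (src G e) ≡ φ₀ v
    φ-parent {v} {e} nt p with On? v
    ... | no n = ancestor-unique (up n p (proj₂ (ancestor (src G e)))) (proj₂ (ancestor v))
    ... | yes o with decidable-stable (PathInto? v) (λ q → nt (o , q))
    ... | x@(e' , _ , (i , m) , refl) with trans (sym p) (parent-on x)
    ... | refl = trans (φ-on (on-src m)) (sym (φ-on (on-tgt m)))

    top-above : ∀ v → U.In v → ∃[ c ] (U.In c × Top c × φ₀ c ≡ φ₀ v × Reach G c v)
    top-above v = go v (⊏-wellFounded acyc v)
      where
      go : ∀ v → Acc (_⊏_ acyc) v → U.In v → ∃[ c ] (U.In c × Top c × φ₀ c ≡ φ₀ v × Reach G c v)
      go v (acc rec) u with Top? v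
      ... | yes top = v , u , top , refl , ε
      ... | no nt with parent-edge u (λ eq → nt (subst Top (sym eq) root-top))
      ... | e , te , refl with go (src G e) (rec (parent-⊏ (proj₂ te))) (treeEdge-src te)
      ... | c , uc , tc , eq , w = c , uc , tc , trans eq (φ-parent nt (proj₂ te)) , w ◅◅ edgeReach e

    -- `R` is closed along a segment, so the later of two tops would be entered by a path edge from
    -- inside `R`.
    top-on : ∀ {i c c'} → R.In c → R.In c' → Top c → Top c' → OnAt i c → OnAt i c' → c ≡ c'
    top-on r r' t t' (inj₁ refl) (inj₁ refl) = refl
    top-on {i} r r' t t' (inj₁ refl) (inj₂ (e , m , refl)) = contradiction
      (e , (R-walk (walk-head-inside (qs i) (qs-walk i) (qs-inside i) m) r , r') , (i , m) , refl) (proj₂ t')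
    top-on {i} r r' t t' (inj₂ (e , m , refl)) (inj₁ refl) = contradiction
      (e , (R-walk (walk-head-inside (qs i) (qs-walk i) (qs-inside i) m) r' , r) , (i , m) , refl) (proj₂ t)
    top-on {i} r r' t t' (inj₂ (e , m , refl)) (inj₂ (e' , m' , refl))
      with walk-linear {G} {X} (qs i) (qs-walk i) (qs-inside i) m m'
    ... | inj₁ refl = refl
    ... | inj₂ (inj₁ w) = contradiction (e' , (R-walk w r , r') , (i , m') , refl) (proj₂ t')
    ... | inj₂ (inj₂ w) = contradiction (e , (R-walk w r' , r) , (i , m) , refl) (proj₂ t)

    top-unique : ∀ {c c'} → U.In c → U.In c' → Top c → Top c' → φ₀ c ≡ φ₀ c' → c ≡ c'
    top-unique u u' t@((i , o) , _) t'@((j , o') , _) eq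
      with trans (sym (φ-on o)) (trans eq (φ-on o'))
    ... | refl = top-on (U-R u) (U-R u') t t' o o'

    on-inn-tgt : ∀ {e} → OnE e → ¬ R.In (src G e) → ¬ PathInto (tgt G e)
    on-inn-tgt o nr (x , (r , _) , o' , eq) with tgt-unique o' o eq
    ... | refl = nr r

    -- The in-tree of a fibre is a mere path, the part of the segment before it enters `R`; all
    -- branching occurs in the out-tree.
    data KindOf (v : Vertex G) : Kind → Set where
      is-cen  : U.In v → Top v → KindOf v cen
      is-out  : U.In v → ¬ Top v → KindOf v out
      is-inn  : On v → ¬ R.In v → KindOf v inn
      is-junk : ¬ U.In v → ¬ On v → KindOf v junk

    opaque
      classify : ∀ v → ∃[ k ] KindOf v k
      classify v with U.In? v | Top? v | On? v
      ... | yes u | yes t | _ = cen , is-cen u t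
      ... | yes u | no nt | _ = out , is-out u nt
      ... | no nu | _ | no no-on = junk , is-junk nu no-on
      ... | no nu | _ | yes o = inn , is-inn o (λ r → nu (U.base (r , o)))

    kind₀ : Vertex G → Kind
    kind₀ v = proj₁ (classify v)

    kind-is : ∀ {v k} → kind₀ v ≡ k → KindOf v k
    kind-is {v} eq = subst (KindOf v) eq (proj₂ (classify v))

    kindOf-unique : ∀ {v k k'} → KindOf v k → KindOf v k' → k ≡ k'
    kindOf-unique (is-cen _ _) (is-cen _ _) = refl
    kindOf-unique (is-cen _ t) (is-out _ nt) = contradiction t nt
    kindOf-unique (is-cen u _) (is-inn _ nr) = contradiction (U-R u) nr
    kindOf-unique (is-cen u _) (is-junk nu _) = contradiction u nu
    kindOf-unique (is-out _ nt) (is-cen _ t) = contradiction t nt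
    kindOf-unique (is-out _ _) (is-out _ _) = refl
    kindOf-unique (is-out u _) (is-inn _ nr) = contradiction (U-R u) nr
    kindOf-unique (is-out u _) (is-junk nu _) = contradiction u nu
    kindOf-unique (is-inn _ nr) (is-cen u _) = contradiction (U-R u) nr
    kindOf-unique (is-inn _ nr) (is-out u _) = contradiction (U-R u) nr
    kindOf-unique (is-inn _ _) (is-inn _ _) = refl
    kindOf-unique (is-inn o _) (is-junk _ no-on) = contradiction o no-on
    kindOf-unique (is-junk nu _) (is-cen u _) = contradiction u nu
    kindOf-unique (is-junk nu _) (is-out u _) = contradiction u nu
    kindOf-unique (is-junk _ no-on) (is-inn o _) = contradiction o no-on
    kindOf-unique (is-junk _ _) (is-junk _ _) = refl

    is-kind : ∀ {v k} → KindOf v k → kind₀ v ≡ k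
    is-kind {v} = kindOf-unique (proj₂ (classify v))

    U-exit : ∀ {v} → U.In v → Exit (kind₀ v)
    U-exit {v} u with classify v
    ... | _ , is-cen _ _ = tt
    ... | _ , is-out _ _ = tt
    ... | _ , is-inn _ nr = contradiction (U-R u) nr
    ... | _ , is-junk nu _ = contradiction u nu

    on-entry : ∀ {v} → On v → ¬ PathInto v → Entry (kind₀ v)
    on-entry {v} o np with classify v
    ... | _ , is-cen _ _ = tt
    ... | _ , is-out _ nt = contradiction (o , np) nt
    ... | _ , is-inn _ _ = tt
    ... | _ , is-junk _ no-on = contradiction o no-on

    data LabelOf (e : Edge G) : Label (Fin n) → Set where
      is-real : ∀ {j} → TreeEdge e → Top (tgt G e) → φ₀ (tgt G e) ≡ ρ j → LabelOf e (real j)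
      is-tree : TreeEdge e → ¬ Top (tgt G e) → LabelOf e tree
      is-path : OnE e → ¬ R.In (src G e) → LabelOf e tree
      is-none : ¬ TreeEdge e → ¬ (OnE e × ¬ R.In (src G e)) → LabelOf e extra

    opaque
      label : ∀ e → ∃[ l ] LabelOf e l
      label e with TreeEdge? e | Top? (tgt G e) | OnE? e ×-dec ¬? (R.In? (src G e))
      ... | yes te | no nt | _ = tree , is-tree te nt
      ... | no nt | _ | yes (o , nr) = tree , is-path o nr
      ... | no nt | _ | no q = extra , is-none nt q
      -- The top of the fibre `i₀` is the root, and an edge from `R` into the root would close a
      -- cycle; hence the index of this fibre is some `ρ j`.
      ... | yes te | yes t | _ with ρ-cover (φ₀ (tgt G e)) not-root
        where
        not-root : φ₀ (tgt G e) ≢ i₀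
        not-root eq = not-into-root (U-R (treeEdge-src te))
          (top-unique (proj₁ te) U-root t root-top (trans eq (sym (φ-on (inj₁ refl)))))
      ... | j , eq = real j , is-real te t (sym eq)

    lab₀ : Edge G → Label (Fin n)
    lab₀ e = proj₁ (label e)

    lab-is : ∀ {e l} → lab₀ e ≡ l → LabelOf e l
    lab-is {e} eq = subst (LabelOf e) eq (proj₂ (label e))

    tree-kept : ∀ {e} → TreeEdge e → lab₀ e ≢ extra
    tree-kept te eq with lab-is eq
    ... | is-none n _ = n te

    path-kept : ∀ {e} → OnE e → ¬ R.In (src G e) → lab₀ e ≢ extra
    path-kept o nr eq with lab-is eq
    ... | is-none _ n = n (o , nr)

    on-kept : ∀ {e} → OnE e → lab₀ e ≢ extra
    on-kept {e} o = [ tree-kept ∘ on-treeEdge o , path-kept o ]′ (toSum (R.In? (src G e)))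

    real-is : ∀ {e j} → lab₀ e ≡ real j → TreeEdge e × Top (tgt G e) × φ₀ (tgt G e) ≡ ρ j
    real-is eq with lab-is eq
    ... | is-real te t p = te , t , p

    tree-label : ∀ {e j} → TreeEdge e → Top (tgt G e) → φ₀ (tgt G e) ≡ ρ j → lab₀ e ≡ real j
    tree-label {e} te t p with label e
    ... | _ , is-real _ _ p' = cong real (ρ-inj (trans (sym p') p))
    ... | _ , is-tree _ nt = contradiction t nt
    ... | _ , is-path _ nr = contradiction (U-R (treeEdge-src te)) nr
    ... | _ , is-none n _ = contradiction te n

    center : ∀ i → ∃[ c ] (U.In c × Top c × φ₀ c ≡ i)
    center i with top-above (σ i) (U.base (R-σ i , i , on-σ i))
    ... | c , u , t , eq , _ = c , u , t , trans eq (φ-on (on-σ i))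

    real-edge : ∀ j → ∃[ e ] lab₀ e ≡ real j
    real-edge j with center (ρ j)
    ... | c , u , t , eq with parent-edge u (λ q → ρ≢i₀ j (trans (sym eq) (trans (cong φ₀ q) (φ-on (inj₁ refl)))))
    ... | e , te , refl = e , tree-label te t eq

    real-unique : ∀ {e e' j} → lab₀ e ≡ real j → lab₀ e' ≡ real j → e ≡ e'
    real-unique l l' with real-is l | real-is l'
    ... | (u , p) , t , q | (u' , p') , t' , q'
      with trans (sym p) (trans (cong parent (top-unique u u' t t' (trans q (sym q')))) p')
    ... | refl = refl

    par₀ : Fin n → Fin (suc n)
    par₀ j = φ₀ (src G (proj₁ (real-edge j)))

    kept-into-out : ∀ {v e} → kind₀ v ≡ out → lab₀ e ≢ extra → tgt G e ≡ v → parent v ≡ just e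
    kept-into-out {e = e} k n refl with label e
    ... | _ , is-real te _ _ = proj₂ te
    ... | _ , is-tree te _ = proj₂ te
    ... | _ , is-none _ _ = contradiction refl n
    ... | _ , is-path o@(i , m) nr = ⊥-elim (subst Entry k (on-entry (i , on-tgt m) (on-inn-tgt o nr)))

    kept-from-inn : ∀ {v e} → kind₀ v ≡ inn → lab₀ e ≢ extra → src G e ≡ v → OnE e
    kept-from-inn {e = e} k n refl with label e
    ... | _ , is-real te _ _ = ⊥-elim (subst Exit k (U-exit (treeEdge-src te)))
    ... | _ , is-tree te _ = ⊥-elim (subst Exit k (U-exit (treeEdge-src te)))
    ... | _ , is-none _ _ = contradiction refl n
    ... | _ , is-path o nr = o

    into : ∀ {v} → kind₀ v ≢ junk → v ≢ s₀ → (∃[ e ] (lab₀ e ≢ extra × tgt G e ≡ v)) ⊎ ∃[ j ] v ≡ y (ρ j)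
    into {v} k v≢ with classify v
    ... | _ , is-junk _ _ = contradiction refl k
    ... | _ , is-cen u _ = let (e , te , eq) = parent-edge u v≢ in inj₁ (e , tree-kept te , eq)
    ... | _ , is-out u _ = let (e , te , eq) = parent-edge u v≢ in inj₁ (e , tree-kept te , eq)
    ... | _ , is-inn (i , inj₂ (e , m , eq)) nr = inj₁ (e , on-kept (i , m) , eq)
    ... | _ , is-inn (i , inj₁ eq) nr =
      let (j , p) = ρ-cover i (λ { refl → v≢ eq }) in inj₂ (j , trans eq (cong y (sym p)))

    along : ∀ {v} → On v → (∃[ e ] (lab₀ e ≢ extra × src G e ≡ v)) ⊎ ∃[ i ] v ≡ σ i
    along (i , o) with on-next o
    ... | inj₁ eq = inj₂ (i , eq)
    ... | inj₂ (e , m , eq) = inj₁ (e , on-kept (i , m) , eq)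

    from-U : ∀ {v} → U.In v → (∃[ e ] (lab₀ e ≢ extra × src G e ≡ v)) ⊎ ∃[ i ] v ≡ σ i
    from-U u with U-out u
    ... | inj₁ o = along o
    ... | inj₂ (e , te , eq) = inj₁ (e , tree-kept te , eq)

    out-of : ∀ {v} → kind₀ v ≢ junk → (∃[ e ] (lab₀ e ≢ extra × src G e ≡ v)) ⊎ ∃[ i ] v ≡ σ i
    out-of {v} k with classify v
    ... | _ , is-junk _ _ = contradiction refl k
    ... | _ , is-cen u _ = from-U u
    ... | _ , is-out u _ = from-U u
    ... | _ , is-inn o _ = along o

    tree-edge-φ : ∀ {e} → lab₀ e ≡ tree → φ₀ (src G e) ≡ φ₀ (tgt G e)
    tree-edge-φ l with lab-is l
    ... | is-tree te nt = φ-parent nt (proj₂ te)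
    ... | is-path (i , m) _ = trans (φ-on (on-src m)) (sym (φ-on (on-tgt m)))

    tree-edge-kind : ∀ {e} → lab₀ e ≡ tree → (Exit (kind₀ (src G e)) × kind₀ (tgt G e) ≡ out)
                                           ⊎ (kind₀ (src G e) ≡ inn × Entry (kind₀ (tgt G e)))
    tree-edge-kind l with lab-is l
    ... | is-tree te nt = inj₁ (U-exit (treeEdge-src te) , is-kind (is-out (proj₁ te) nt))
    ... | is-path o@(i , m) nr = inj₂ (is-kind (is-inn (i , on-src m) nr)
                                     , on-entry (i , on-tgt m) (on-inn-tgt o nr))

    kind-X : ∀ {v} → kind₀ v ≢ junk → X v
    kind-X {v} k with classify v
    ... | _ , is-junk _ _ = contradiction refl k
    ... | _ , is-cen u _ = R-X (U-R u)
    ... | _ , is-out u _ = R-X (U-R u)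
    ... | _ , is-inn (i , o) _ = on-X o

    y-not-into : ∀ i → ¬ PathInto (y i)
    y-not-into i (e , _ , (j , m) , eq) with on-unique (subst (OnAt j) eq (on-tgt m)) (inj₁ refl)
    ... | refl = acyc e (subst (λ v → Reach G v (src G e)) (sym eq) (walk-head (qs i) (qs-walk i) m))

    top-is-cen : ∀ {v} → kind₀ v ≡ cen → U.In v × Top v
    top-is-cen k with kind-is k
    ... | is-cen u t = u , t

    -- Climbing from the tail of the real edge leads to the centre of the parent's fibre, which lies
    -- on the segment of that index; this links the start of one segment to the end of another.
    -- Equal indices would make this centre the head of the edge and close a cycle.
    real-parent : ∀ j → Reach G (y (par₀ j)) (σ (ρ j)) × par₀ j ≢ ρ j
    real-parent j with real-edge j
    ... | e , l with real-is l
    ... | te , t@((i , o) , _) , eq with top-above (src G e) (treeEdge-src te)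
    ... | c , uc , tc@((k , oc) , _) , eqc , w =
      subst (λ k → Reach G (y k) (σ (ρ j))) (trans (sym (φ-on oc)) eqc)
        (on-from oc ◅◅ w ◅◅ edgeReach e ◅◅ subst (λ k → Reach G (tgt G e) (σ k)) (trans (sym (φ-on o)) eq) (on-to o)) ,
      λ q → acyc e (subst (λ v → Reach G v (src G e))
                     (top-unique uc (proj₁ te) tc t (trans eqc (trans q (sym eq)))) w)

  sideModel : SideModel G X ρ i₀ y σ
  sideModel = record
    { kind = kind₀ ; φ = φ₀ ; lab = lab₀ ; par = par₀
    ; in-X = kind-X
    ; real-src = λ {e} {j} l → cong (φ₀ ∘ src G) (real-unique l (proj₂ (real-edge j)))
                             , U-exit (treeEdge-src (proj₁ (real-is l)))
    ; real-tgt = λ l → let (_ , t , eq) = real-is l in eq , on-entry (proj₁ t) (proj₂ t)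
    ; tree-φ = tree-edge-φ ; tree-kind = tree-edge-kind
    ; real-sur = real-edge ; real-inj = real-unique
    ; cen-sur = λ i → let (c , u , t , eq) = center i in c , is-kind (is-cen u t) , eq
    ; cen-inj = λ k k' eq → let (u , t) = top-is-cen k
                                (u' , t') = top-is-cen k'
                            in top-unique u u' t t' eq
    ; cen-root = is-kind (is-cen U-root root-top)
    ; out-uniq = λ k n p n' p' → Maybe.just-injective
        (trans (sym (kept-into-out k n p)) (kept-into-out k n' p'))
    ; inn-uniq = λ k n p n' p' → src-unique (kept-from-inn k n p) (kept-from-inn k n' p') (trans p (sym p'))
    ; has-in = into ; has-out = out-of
    ; y-entry = λ i → on-entry (i , inj₁ refl) (y-not-into i)
    ; y-φ = λ i → φ-on (inj₁ refl)
    ; σ-exit = λ i → U-exit (U.base (R-σ i , i , on-σ i))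
    ; σ-φ = λ i → φ-on (on-σ i)
    ; par-reach = λ j → proj₁ (real-parent j)
    ; par≢ = λ j → proj₂ (real-parent j)
    }

-- From a cut to a variant

module _ (G : Graph) where

  ups : ∀ {n} → Vertex G → (Fin n → Edge G) → Fin (suc n) → Vertex G
  ups v c zero = v
  ups v c (suc i) = tgt G (c i)

  -- The exceptional stretch outside the set is the last one, which ends at the sink, while `Fin`
  -- splits off its first element; hence the recursion on `n` and the two lemmas below.
  downs : ∀ {n} → (Fin n → Edge G) → Fin (suc n) → Vertex G
  downs {zero} c zero = t G
  downs {suc n} c zero = src G (c zero)
  downs {suc n} c (suc i) = downs (c ∘ suc) i

  downs-inject₁ : ∀ {n} (c : Fin n → Edge G) i → downs c (inject₁ i) ≡ src G (c i)
  downs-inject₁ c zero = refl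
  downs-inject₁ c (suc i) = downs-inject₁ (c ∘ suc) i

  downs-fromℕ : ∀ {n} (c : Fin n → Edge G) → downs c (fromℕ n) ≡ t G
  downs-fromℕ {zero} c = refl
  downs-fromℕ {suc n} c = downs-fromℕ (c ∘ suc)

-- A walk from v to t crossing from X to its complement exactly n + 1 times, along the edges rung i,
-- and back along the edges return i.
record Ladder (G : Graph) (X : Vertex G → Set) (C : Subset (ne G)) (v : Vertex G) (n : ℕ) : Set where
  field
    rung   : Fin (suc n) → Edge G
    return : Fin n → Edge G
    rung∈C : ∀ i → rung i Sub.∈ C
    return-src : ∀ i → ¬ X (src G (return i))
    return-tgt : ∀ i → X (tgt G (return i))
    up   : ∀ i → Walk G X (ups G v return i) (src G (rung i))
    down : ∀ i → Walk G (¬_ ∘ X) (tgt G (rung i)) (downs G return i)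

∣p∣≤1+∣p-x∣ : ∀ {n} (p : Subset n) x → ∣ p ∣ ≤ suc ∣ p Sub.- x ∣
∣p∣≤1+∣p-x∣ (inside ∷ p) zero = s≤s (ℕ.≤-reflexive (cong ∣_∣ (sym (p─⊥≡p p))))
∣p∣≤1+∣p-x∣ (outside ∷ p) zero = ℕ.m≤n⇒m≤1+n (ℕ.≤-reflexive (cong ∣_∣ (sym (p─⊥≡p p))))
∣p∣≤1+∣p-x∣ (inside ∷ p) (suc x) = s≤s (∣p∣≤1+∣p-x∣ p x)
∣p∣≤1+∣p-x∣ (outside ∷ p) (suc x) = ∣p∣≤1+∣p-x∣ p x

module Crossings (G : Graph) {X : Vertex G → Set} (X? : Decidable X) (¬X-t : ¬ X (t G)) (C : Subset (ne G))
                 (crossing : ∀ {e} → X (src G e) → ¬ X (tgt G e) → e Sub.∈ C)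
                 (C-src : ∀ {e} → e Sub.∈ C → X (src G e)) (C-tgt : ∀ {e} → e Sub.∈ C → ¬ X (tgt G e)) where

  data Up (v : Vertex G) : ℕ → Set
  data Down (v : Vertex G) : ℕ → Set

  data Up v where
    over : ∀ {m} e → Walk G X v (src G e) → e Sub.∈ C → Down (tgt G e) m → Up v (suc m)

  data Down v where
    stop : Walk G (¬_ ∘ X) v (t G) → Down v 0
    turn : ∀ {m} c → Walk G (¬_ ∘ X) v (src G c) → ¬ X (src G c) → X (tgt G c) → Up (tgt G c) m → Down v m

  extend-up : ∀ {m} e → X (src G e) → X (tgt G e) → Up (tgt G e) m → Up (src G e) m
  extend-up e p q (over x w m d) = over x (edgeWalk {G} e p q ◅◅ w) m d

  extend-down : ∀ {m} e → ¬ X (src G e) → ¬ X (tgt G e) → Down (tgt G e) m → Down (src G e) m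
  extend-down e p q (stop w) = stop (edgeWalk {G} e p q ◅◅ w)
  extend-down e p q (turn c w x y u) = turn c (edgeWalk {G} e p q ◅◅ w) x y u

  Crosses : Subset (ne G) → Vertex G → Set
  Crosses S v = ∃[ m ] (∣ S ∣ ≤ m × (X v → Up v m) × (¬ X v → Down v m))

  -- All edges of `C` lead from `X` to its complement, so edges of `S` are met only at crossings,
  -- one at a time. Crossings by edges outside `S` merely increase the count.
  crosses : ∀ {v} es → IsWalk G v (t G) es → ∀ S → S Sub.⊆ C → (∀ {e} → e Sub.∈ S → e ∈ es) → Crosses S v
  crosses [] refl S S⊆C S⊆es = 0 , ℕ.≤-reflexive empty , (λ x → contradiction x ¬X-t) , (λ _ → stop ε)
    where
    empty : ∣ S ∣ ≡ 0
    empty = trans (cong ∣_∣ (Empty-unique {p = S} λ { (x , m) → contradiction (S⊆es m) λ () })) (∣⊥∣≡0 (ne G))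
  crosses (e ∷ es) (refl , ok) S S⊆C S⊆es with X? (src G e) | X? (tgt G e)
  ... | yes p | no ¬q =
    let (m , le , _ , d) = crosses es ok (S Sub.- e) (S⊆C ∘ p─q⊆p S _) rest
    in suc m , ℕ.≤-trans (∣p∣≤1+∣p-x∣ S e) (s≤s le) , (λ _ → over e ε (crossing p ¬q) (d ¬q)) , contradiction p
    where
    rest : ∀ {x} → x Sub.∈ S Sub.- e → x ∈ es
    rest {x} m with S⊆es (p─q⊆p S _ m)
    ... | there m' = m'
    ... | here refl = contradiction m (x∉p-x S)
      where
      x∉p-x : ∀ {n} (p : Subset n) {x} → ¬ x Sub.∈ p Sub.- x
      x∉p-x (_ ∷ p) {suc x} (Vec.there m) = x∉p-x p m
      x∉p-x (true ∷ p) {zero} ()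
      x∉p-x (false ∷ p) {zero} ()
  ... | yes p | yes q = keep (λ m → C-tgt (S⊆C m) q) (λ u → extend-up e p q (u q)) (contradiction p)
    where
    keep : ¬ e Sub.∈ S → (∀ {m} → (X (tgt G e) → Up (tgt G e) m) → Up (src G e) m) →
           (∀ {m} → ¬ X (src G e) → Down (src G e) m) → Crosses S (src G e)
    keep n f g = let (m , le , u , d) = crosses es ok S S⊆C (λ x∈S → Any.tail (λ { refl → n x∈S }) (S⊆es x∈S))
                 in m , le , (λ _ → f u) , g
  ... | no ¬p | yes q =
    let (m , le , u , _) = crosses es ok S S⊆C (λ x∈S → Any.tail (λ { refl → ¬p (C-src (S⊆C x∈S)) }) (S⊆es x∈S))
    in m , le , (λ p → contradiction p ¬p) , (λ _ → turn e ε ¬p q (u q))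
  ... | no ¬p | no ¬q =
    let (m , le , _ , d) = crosses es ok S S⊆C (λ x∈S → Any.tail (λ { refl → ¬p (C-src (S⊆C x∈S)) }) (S⊆es x∈S))
    in m , le , (λ p → contradiction p ¬p) , (λ _ → extend-down e ¬p ¬q (d ¬q))

  -- The surplus is dropped at the front because the end must remain at the sink, whereas a new
  -- beginning can be supplied: the tail of each cut edge is reachable from the source inside `X`.
  last-crossings : ∀ {m v} n → Up v m → suc n ≤ m → ∃[ u ] Up u (suc n)
  last-crossings n u@(over {m} e w c d) (s≤s n≤m) with m ℕ.≟ n
  ... | yes refl = _ , u
  last-crossings n (over e w c (stop _)) (s≤s z≤n) | no m≢n = contradiction refl m≢n
  last-crossings n (over e w c (turn x _ _ _ u)) (s≤s n≤m) | no m≢n =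
    last-crossings n u (ℕ.≤∧≢⇒< n≤m (m≢n ∘ sym))

  ladder : ∀ {n v} → Up v (suc n) → Ladder G X C v n
  ladder {zero} (over e w c (stop w')) = record
    { rung = λ _ → e ; return = λ () ; rung∈C = λ _ → c ; return-src = λ () ; return-tgt = λ ()
    ; up = λ { zero → w } ; down = λ { zero → w' } }
  ladder {suc n} (over e w c (turn x w' p q u)) = record
    { rung = λ { zero → e ; (suc i) → L.rung i }
    ; return = λ { zero → x ; (suc i) → L.return i }
    ; rung∈C = λ { zero → c ; (suc i) → L.rung∈C i }
    ; return-src = λ { zero → p ; (suc i) → L.return-src i }
    ; return-tgt = λ { zero → q ; (suc i) → L.return-tgt i }
    ; up = λ { zero → w ; (suc zero) → L.up zero ; (suc (suc i)) → L.up (suc i) }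
    ; down = λ { zero → w' ; (suc i) → L.down i } }
    where
    module L = Ladder (ladder u)

opKind : Kind → Kind
opKind junk = junk
opKind cen  = cen
opKind out  = inn
opKind inn  = out

opKind-involutive : ∀ k → opKind (opKind k) ≡ k
opKind-involutive junk = refl
opKind-involutive cen = refl
opKind-involutive out = refl
opKind-involutive inn = refl

opKind-exit : ∀ {k} → Entry k → Exit (opKind k)
opKind-exit {cen} _ = tt
opKind-exit {inn} _ = tt

opKind-entry : ∀ {k} → Exit k → Entry (opKind k)
opKind-entry {cen} _ = tt
opKind-entry {out} _ = tt

opKind-flip : ∀ {k k'} → opKind k ≡ k' → k ≡ opKind k'
opKind-flip {k} eq = trans (sym (opKind-involutive k)) (cong opKind eq)

data Inspected {A : Set} (l : Label A) : Set where
  an-extra : l ≡ extra → Inspected l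
  a-tree   : l ≡ tree → Inspected l
  a-real   : ∀ {a} → l ≡ real a → Inspected l

inspectLabel : ∀ {A} (l : Label A) → Inspected l
inspectLabel extra    = an-extra refl
inspectLabel tree     = a-tree refl
inspectLabel (real _) = a-real refl

-- Gluing the models of the two sides along a ladder

module FromLadder {G : Graph} (F : Flow G) {X : Vertex G → Set} (X? : Decidable X) (X-s : X (s G))
                  (¬X-t : ¬ X (t G)) (C : Subset (ne G))
                  (C-src : ∀ {e} → e Sub.∈ C → X (src G e)) (C-tgt : ∀ {e} → e Sub.∈ C → ¬ X (tgt G e))
                  (from : ∀ {e} → e Sub.∈ C → Walk G X (s G) (src G e))
                  (to : ∀ {e} → e Sub.∈ C → Walk G (¬_ ∘ X) (tgt G e) (t G))
                  {n : ℕ} (L : Ladder G X C (s G) n) where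
  open Ladder L

  y x σ τ : Fin (suc n) → Vertex G
  y = ups G (s G) return
  x = downs G return
  σ = src G ∘ rung
  τ = tgt G ∘ rung

  rung-walk : ∀ i → Reach G (y i) (x i)
  rung-walk i = forget (up i) ◅◅ edgeReach (rung i) ◅◅ forget (down i)

  return-walk : ∀ i → Reach G (x (inject₁ i)) (y (suc i))
  return-walk i = subst (λ v → Reach G v (y (suc i))) (sym (downs-inject₁ G return i)) (edgeReach (return i))

  climb : ∀ fuel i j → toℕ j ≤ fuel → i < j → Reach G (x i) (y j)
  climb (suc fuel) i (suc j) (s≤s le) (s≤s i≤j) with i ≟ inject₁ j
  ... | yes refl = return-walk j
  ... | no  i≢j  = climb fuel i (inject₁ j) (subst (_≤ fuel) (sym (Fin.toℕ-inject₁ j)) le)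
                     (ℕ.≤∧≢⇒< (subst (toℕ i ≤_) (sym (Fin.toℕ-inject₁ j)) i≤j) (i≢j ∘ Fin.toℕ-injective))
                   ◅◅ rung-walk (inject₁ j) ◅◅ return-walk j

  -- The ladder itself leads from the head of `rung i` to `y j`, so a way back to the tail would
  -- close a cycle. Both the disjointness of the segments and the validity of the out-tree rest on
  -- this.
  no-return : ∀ {i j} → i < j → ¬ Reach G (y j) (σ i)
  no-return {i} {j} i<j w = acyclic F (rung i) (forget (down i) ◅◅ climb (toℕ j) i j ℕ.≤-refl i<j ◅◅ w)

  no-return' : ∀ {i j} → i < j → ¬ Reach G (τ j) (x i)
  no-return' {i} {j} i<j w = acyclic F (rung j) (w ◅◅ climb (toℕ j) i j ℕ.≤-refl i<j ◅◅ forget (up j))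

  sideA : Side G X suc zero y σ
  sideA = record
    { ρ≢i₀ = λ _ () ; ρ-inj = Fin.suc-injective
    ; ρ-cover = λ { zero n → contradiction refl n ; (suc i) _ → i , refl }
    ; y∈X = λ { zero → X-s ; (suc i) → return-tgt i }
    ; segment = up ; root-to = λ i → from (rung∈C i)
    ; disjoint = apart }
    where
    apart : ∀ {i j v} → Reach G (y i) v → Reach G v (σ i) → Reach G (y j) v → Reach G v (σ j) → i ≡ j
    apart {i} {j} a b c d with Fin.<-cmp i j
    ... | tri< l _ _ = contradiction (c ◅◅ b) (no-return l)
    ... | tri≈ _ eq _ = eq
    ... | tri> _ _ l = contradiction (a ◅◅ d) (no-return l)

  -- With edges reversed, a segment runs from `x i`, where the walk returns to `X` or ends, back to
  -- the head of the rung. The root is the sink and has the last index, hence `inject₁` and `fromℕ`.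
  sideB : Side (op G) (¬_ ∘ X) inject₁ (fromℕ n) x τ
  sideB = record
    { ρ≢i₀ = λ j eq → Fin.fromℕ≢inject₁ (sym eq)
    ; ρ-inj = Fin.inject₁-injective
    ; ρ-cover = cover
    ; y∈X = outside-X
    ; segment = λ i → reverse (down i)
    ; root-to = λ i → subst (λ v → Walk (op G) (¬_ ∘ X) v (τ i)) (sym (downs-fromℕ G return)) (reverse (to (rung∈C i)))
    ; disjoint = apart }
    where
    cover : ∀ i → i ≢ fromℕ n → ∃[ j ] inject₁ j ≡ i
    cover i ne with topView i
    ... | ‵fromℕ = contradiction refl ne
    ... | ‵inject₁ j = j , refl
    outside-X : ∀ i → ¬ X (x i)
    outside-X i with topView i
    ... | ‵fromℕ = subst (¬_ ∘ X) (sym (downs-fromℕ G return)) ¬X-t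
    ... | ‵inject₁ j = subst (¬_ ∘ X) (sym (downs-inject₁ G return j)) (return-src j)
    apart : ∀ {i j v} → Reach (op G) (x i) v → Reach (op G) v (τ i) →
            Reach (op G) (x j) v → Reach (op G) v (τ j) → i ≡ j
    apart {i} {j} a b c d with Fin.<-cmp i j
    ... | tri< l _ _ = contradiction (reverse (a ◅◅ d)) (no-return' l)
    ... | tri≈ _ eq _ = eq
    ... | tri> _ _ l = contradiction (reverse (c ◅◅ b)) (no-return' l)

  opaque
    modelA : SideModel G X suc zero y σ
    modelA = BuildSide.sideModel (acyclic F) X? sideA

    modelB : SideModel (op G) (¬_ ∘ X) inject₁ (fromℕ n) x τ
    modelB = BuildSide.sideModel (acyclic (opFlow F)) (λ v → ¬? (X? v)) sideB

  module A = SideModel modelA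
  module B = SideModel modelB

  module V = Variant n A.par B.par

  valid : ValidVariant n A.par B.par
  valid = validA , validB
    where
    validA : ∀ j → toℕ (A.par j) ≤ toℕ j
    validA j with Fin.<-cmp (A.par j) (suc j)
    ... | tri< (s≤s le) _ _ = le
    ... | tri≈ _ eq _ = contradiction eq (A.par≢ j)
    ... | tri> _ _ l = contradiction (A.par-reach j) (no-return l)
    validB : ∀ j → suc (toℕ j) ≤ toℕ (B.par j)
    validB j with Fin.<-cmp (B.par j) (inject₁ j)
    ... | tri< l _ _ = contradiction (reverse (B.par-reach j)) (no-return' l)
    ... | tri≈ _ eq _ = contradiction eq (B.par≢ j)
    ... | tri> _ _ l = subst (λ m → suc m ≤ toℕ (B.par j)) (Fin.toℕ-inject₁ j) l

  kindAt : ∀ v → Dec (X v) → Kind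
  kindAt v (yes _) = A.kind v
  kindAt v (no _)  = opKind (B.kind v)

  φAt : ∀ v → Dec (X v) → Vertex V.H
  φAt v (yes _) = V.a (A.φ v)
  φAt v (no _)  = V.b (B.φ v)

  kind : Vertex G → Kind
  kind v = kindAt v (X? v)

  φ : Vertex G → Vertex V.H
  φ v = φAt v (X? v)

  kind-A : ∀ {v} → X v → kind v ≡ A.kind v
  kind-A {v} p with X? v
  ... | yes _ = refl
  ... | no ¬p = contradiction p ¬p

  kind-B : ∀ {v} → ¬ X v → kind v ≡ opKind (B.kind v)
  kind-B {v} ¬p with X? v
  ... | yes p = contradiction p ¬p
  ... | no _ = refl

  φ-A : ∀ {v} → X v → φ v ≡ V.a (A.φ v)
  φ-A {v} p with X? v
  ... | yes _ = refl
  ... | no ¬p = contradiction p ¬p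

  φ-B : ∀ {v} → ¬ X v → φ v ≡ V.b (B.φ v)
  φ-B {v} ¬p with X? v
  ... | yes p = contradiction p ¬p
  ... | no _ = refl

  data Names (e : Edge G) : V.EdgeName → Set where
    namesA     : ∀ {j} → A.lab e ≡ real j → Names e (treeA j)
    namesB     : ∀ {j} → B.lab e ≡ real j → Names e (treeB j)
    namesCross : ∀ {i} → e ≡ rung i → Names e (cross i)
    namesBack  : ∀ {i} → e ≡ return i → Names e (back i)

  data LabelOf (e : Edge G) : Label (Edge V.H) → Set where
    is-real  : ∀ {z} → Names e z → LabelOf e (real (V.name z))
    is-treeA : A.lab e ≡ tree → LabelOf e tree
    is-treeB : B.lab e ≡ tree → LabelOf e tree
    is-none  : A.lab e ≡ extra → B.lab e ≡ extra → (∀ z → ¬ Names e z) → LabelOf e extra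

  A-src : ∀ {e} → A.lab e ≢ extra → X (src G e)
  A-src {e} k with A.lab e in eq
  ... | extra = contradiction refl k
  ... | real _ = A.in-X (exit≢junk (proj₂ (A.real-src eq)))
  ... | tree with A.tree-kind eq
  ... | inj₁ (p , _) = A.in-X (exit≢junk p)
  ... | inj₂ (p , _) = A.in-X (λ q → contradiction (trans (sym p) q) λ ())

  A-tgt : ∀ {e} → A.lab e ≢ extra → X (tgt G e)
  A-tgt {e} k with A.lab e in eq
  ... | extra = contradiction refl k
  ... | real _ = A.in-X (entry≢junk (proj₂ (A.real-tgt eq)))
  ... | tree with A.tree-kind eq
  ... | inj₁ (_ , p) = A.in-X (λ q → contradiction (trans (sym p) q) λ ())
  ... | inj₂ (_ , p) = A.in-X (entry≢junk p)

  B-tgt : ∀ {e} → B.lab e ≢ extra → ¬ X (tgt G e)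
  B-tgt {e} k with B.lab e in eq
  ... | extra = contradiction refl k
  ... | real _ = B.in-X (exit≢junk (proj₂ (B.real-src eq)))
  ... | tree with B.tree-kind eq
  ... | inj₁ (p , _) = B.in-X (exit≢junk p)
  ... | inj₂ (p , _) = B.in-X (λ q → contradiction (trans (sym p) q) λ ())

  B-src : ∀ {e} → B.lab e ≢ extra → ¬ X (src G e)
  B-src {e} k with B.lab e in eq
  ... | extra = contradiction refl k
  ... | real _ = B.in-X (entry≢junk (proj₂ (B.real-tgt eq)))
  ... | tree with B.tree-kind eq
  ... | inj₁ (_ , p) = B.in-X (λ q → contradiction (trans (sym p) q) λ ())
  ... | inj₂ (_ , p) = B.in-X (entry≢junk p)

  named : ∀ {A : Set} {l : Label A} {a} → l ≡ real a → l ≢ extra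
  named refl ()

  is-tree≢ : ∀ {A : Set} {l : Label A} → l ≡ tree → l ≢ extra
  is-tree≢ refl ()

  σ∈X : ∀ i → X (σ i)
  σ∈X i = C-src (rung∈C i)

  τ∉X : ∀ i → ¬ X (τ i)
  τ∉X i = C-tgt (rung∈C i)

  return-injective : ∀ {i j} → return i ≡ return j → i ≡ j
  return-injective {i} {j} eq = Fin.suc-injective (trans (sym (A.y-φ (suc i)))
    (trans (cong (A.φ ∘ tgt G) eq) (A.y-φ (suc j))))

  rung-injective : ∀ {i j} → rung i ≡ rung j → i ≡ j
  rung-injective {i} {j} eq = trans (sym (A.σ-φ i)) (trans (cong (A.φ ∘ src G) eq) (A.σ-φ j))

  -- The four roles differ in which endpoints lie in `X`: both for an edge of the out-tree, neither
  -- for one of the in-tree, only the tail for a rung, only the head for a return edge. Within one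
  -- role the index is recovered from the labels or from the fibres.
  names-unique : ∀ {e z z'} → Names e z → Names e z' → z ≡ z'
  names-unique (namesA l) (namesA l') with trans (sym l) l'
  ... | refl = refl
  names-unique (namesB l) (namesB l') with trans (sym l) l'
  ... | refl = refl
  names-unique (namesCross p) (namesCross q) = cong (λ i → cross i) (rung-injective (trans (sym p) q))
  names-unique (namesBack p) (namesBack q) = cong (λ i → back i) (return-injective (trans (sym p) q))
  names-unique (namesA l) (namesB l') = contradiction (A-src (named l)) (B-src (named l'))
  names-unique (namesA l) (namesCross refl) = contradiction (A-tgt (named l)) (τ∉X _)
  names-unique (namesA l) (namesBack refl) = contradiction (A-src (named l)) (return-src _)
  names-unique (namesB l) (namesA l') = contradiction (A-src (named l')) (B-src (named l))
  names-unique (namesB l) (namesCross refl) = contradiction (σ∈X _) (B-src (named l))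
  names-unique (namesB l) (namesBack refl) = contradiction (return-tgt _) (B-tgt (named l))
  names-unique (namesCross refl) (namesA l) = contradiction (A-tgt (named l)) (τ∉X _)
  names-unique (namesCross refl) (namesB l) = contradiction (σ∈X _) (B-src (named l))
  names-unique (namesCross refl) (namesBack q) = contradiction (subst (X ∘ src G) q (σ∈X _)) (return-src _)
  names-unique (namesBack refl) (namesA l) = contradiction (A-src (named l)) (return-src _)
  names-unique (namesBack refl) (namesB l) = contradiction (return-tgt _) (B-tgt (named l))
  names-unique (namesBack refl) (namesCross q) = contradiction (subst (X ∘ src G) (sym q) (σ∈X _)) (return-src _)

  names-A≢tree : ∀ {e z} → Names e z → A.lab e ≢ tree
  names-A≢tree (namesA l) q = contradiction (trans (sym l) q) λ ()
  names-A≢tree (namesB l) q = B-src (named l) (A-src (is-tree≢ q))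
  names-A≢tree (namesCross refl) q = τ∉X _ (A-tgt (is-tree≢ q))
  names-A≢tree (namesBack refl) q = return-src _ (A-src (is-tree≢ q))

  names-B≢tree : ∀ {e z} → Names e z → B.lab e ≢ tree
  names-B≢tree (namesA l) q = B-src (is-tree≢ q) (A-src (named l))
  names-B≢tree (namesB l) q = contradiction (trans (sym l) q) λ ()
  names-B≢tree (namesCross refl) q = B-src (is-tree≢ q) (σ∈X _)
  names-B≢tree (namesBack refl) q = B-tgt (is-tree≢ q) (return-tgt _)

  opaque
    label : ∀ e → ∃[ l ] LabelOf e l
    label e = decide (inspectLabel (A.lab e)) (inspectLabel (B.lab e))
                     (Fin.any? (λ i → e ≟ rung i)) (Fin.any? (λ i → e ≟ return i))
      where
      decide : Inspected (A.lab e) → Inspected (B.lab e) → Dec (∃[ i ] e ≡ rung i) →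
               Dec (∃[ i ] e ≡ return i) → ∃[ l ] LabelOf e l
      decide (a-real eqA) _ _ _ = _ , is-real (namesA eqA)
      decide (a-tree eqA) _ _ _ = _ , is-treeA eqA
      decide (an-extra _) (a-real eqB) _ _ = _ , is-real (namesB eqB)
      decide (an-extra _) (a-tree eqB) _ _ = _ , is-treeB eqB
      decide (an-extra _) (an-extra _) (yes (_ , p)) _ = _ , is-real (namesCross p)
      decide (an-extra _) (an-extra _) (no _) (yes (_ , p)) = _ , is-real (namesBack p)
      decide (an-extra eqA) (an-extra eqB) (no ¬r) (no ¬b) = _ , is-none eqA eqB λ
        { _ (namesA l) → contradiction (trans (sym eqA) l) λ ()
        ; _ (namesB l) → contradiction (trans (sym eqB) l) λ ()
        ; _ (namesCross p) → ¬r (_ , p)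
        ; _ (namesBack p) → ¬b (_ , p) }

  lab : Edge G → Label (Edge V.H)
  lab e = proj₁ (label e)

  Kept : Edge G → Set
  Kept e = lab e ≢ extra

  names-label : ∀ {e z} → Names e z → lab e ≡ real (V.name z)
  names-label {e} nz with label e
  ... | _ , is-real nz' = cong (real ∘ V.name) (names-unique nz' nz)
  ... | _ , is-treeA l = contradiction l (names-A≢tree nz)
  ... | _ , is-treeB l = contradiction l (names-B≢tree nz)
  ... | _ , is-none _ _ no-name = contradiction nz (no-name _)

  label-names : ∀ {e h} → lab e ≡ real h → Names e (V.unname h)
  label-names {e} eq with label e
  label-names {e} refl | _ , is-real {z} nz = subst (Names e) (sym (V.unname-name z)) nz

  names-kept : ∀ {e z} → Names e z → Kept e
  names-kept nz = named (names-label nz)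

  A-kept : ∀ {e} → A.lab e ≢ extra → Kept e
  A-kept {e} k with label e
  ... | _ , is-real _ = λ ()
  ... | _ , is-treeA _ = λ ()
  ... | _ , is-treeB _ = λ ()
  ... | _ , is-none l _ _ = contradiction l k

  B-kept : ∀ {e} → B.lab e ≢ extra → Kept e
  B-kept {e} k with label e
  ... | _ , is-real _ = λ ()
  ... | _ , is-treeA _ = λ ()
  ... | _ , is-treeB _ = λ ()
  ... | _ , is-none _ l _ = contradiction l k

  names-src : ∀ {e z} → Names e z → φ (src G e) ≡ V.source z × Exit (kind (src G e))
  names-src (namesA l) = let (p , q) = A.real-src l ; p∈X = A-src (named l) in
    trans (φ-A p∈X) (cong V.a p) , subst Exit (sym (kind-A p∈X)) q
  names-src (namesB l) = let (p , q) = B.real-tgt l ; p∉X = B-src (named l) in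
    trans (φ-B p∉X) (cong V.b p) , subst Exit (sym (kind-B p∉X)) (opKind-exit q)
  names-src (namesCross {i} refl) =
    trans (φ-A (σ∈X i)) (cong V.a (A.σ-φ i)) , subst Exit (sym (kind-A (σ∈X i))) (A.σ-exit i)
  names-src (namesBack {i} refl) =
    trans (φ-B (return-src i)) (cong V.b (trans (cong B.φ (sym (downs-inject₁ G return i))) (B.y-φ (inject₁ i)))) ,
    subst Exit (sym (kind-B (return-src i)))
      (opKind-exit (subst (Entry ∘ B.kind) (downs-inject₁ G return i) (B.y-entry (inject₁ i))))

  names-tgt : ∀ {e z} → Names e z → φ (tgt G e) ≡ V.target z × Entry (kind (tgt G e))
  names-tgt (namesA l) = let (p , q) = A.real-tgt l ; p∈X = A-tgt (named l) in
    trans (φ-A p∈X) (cong V.a p) , subst Entry (sym (kind-A p∈X)) q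
  names-tgt (namesB l) = let (p , q) = B.real-src l ; p∉X = B-tgt (named l) in
    trans (φ-B p∉X) (cong V.b p) , subst Entry (sym (kind-B p∉X)) (opKind-entry q)
  names-tgt (namesCross {i} refl) =
    trans (φ-B (τ∉X i)) (cong V.b (B.σ-φ i)) , subst Entry (sym (kind-B (τ∉X i))) (opKind-entry (B.σ-exit i))
  names-tgt (namesBack {i} refl) =
    trans (φ-A (return-tgt i)) (cong V.a (A.y-φ (suc i))) , subst Entry (sym (kind-A (return-tgt i))) (A.y-entry (suc i))

  names-same : ∀ {e e' z} → Names e z → Names e' z → e ≡ e'
  names-same (namesA l) (namesA l') = A.real-inj l l'
  names-same (namesB l) (namesB l') = B.real-inj l l'
  names-same (namesCross p) (namesCross q) = trans p (sym q)
  names-same (namesBack p) (namesBack q) = trans p (sym q)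

  named-edge : ∀ z → ∃[ e ] Names e z
  named-edge (treeA j) = let (e , l) = A.real-sur j in e , namesA l
  named-edge (treeB j) = let (e , l) = B.real-sur j in e , namesB l
  named-edge (cross i) = rung i , namesCross refl
  named-edge (back i)  = return i , namesBack refl

  tree-sides : ∀ {e} → lab e ≡ tree → A.lab e ≡ tree ⊎ B.lab e ≡ tree
  tree-sides {e} eq with label e
  ... | _ , is-treeA l = inj₁ l
  ... | _ , is-treeB l = inj₂ l

  -- The edges joining the two sides do not disturb the uniqueness at tree vertices: a return edge
  -- arrives at some `y`, which is an `Entry` and hence not of kind `out`, and a rung ends outside
  -- `X`. The three companions are the mirror images.
  kept-in-A : ∀ {v e} → X v → A.kind v ≡ out → Kept e → tgt G e ≡ v → A.lab e ≢ extra
  kept-in-A {e = e} p k kept refl with label e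
  ... | _ , is-real (namesA l) = named l
  ... | _ , is-real (namesB l) = contradiction p (B-tgt (named l))
  ... | _ , is-real (namesCross refl) = contradiction p (τ∉X _)
  ... | _ , is-real (namesBack {i} refl) = ⊥-elim (subst Entry k (A.y-entry (suc i)))
  ... | _ , is-treeA l = is-tree≢ l
  ... | _ , is-treeB l = contradiction p (B-tgt (is-tree≢ l))
  ... | _ , is-none _ _ _ = contradiction refl kept

  kept-out-A : ∀ {v e} → X v → A.kind v ≡ inn → Kept e → src G e ≡ v → A.lab e ≢ extra
  kept-out-A {e = e} p k kept refl with label e
  ... | _ , is-real (namesA l) = named l
  ... | _ , is-real (namesB l) = contradiction p (B-src (named l))
  ... | _ , is-real (namesCross {i} refl) = ⊥-elim (subst Exit k (A.σ-exit i))
  ... | _ , is-real (namesBack {i} refl) = contradiction p (return-src i)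
  ... | _ , is-treeA l = is-tree≢ l
  ... | _ , is-treeB l = contradiction p (B-src (is-tree≢ l))
  ... | _ , is-none _ _ _ = contradiction refl kept

  kept-in-B : ∀ {v e} → ¬ X v → B.kind v ≡ inn → Kept e → tgt G e ≡ v → B.lab e ≢ extra
  kept-in-B {e = e} p k kept refl with label e
  ... | _ , is-real (namesA l) = contradiction (A-tgt (named l)) p
  ... | _ , is-real (namesB l) = named l
  ... | _ , is-real (namesCross {i} refl) = ⊥-elim (subst Exit k (B.σ-exit i))
  ... | _ , is-real (namesBack {i} refl) = contradiction (return-tgt i) p
  ... | _ , is-treeA l = contradiction (A-tgt (is-tree≢ l)) p
  ... | _ , is-treeB l = is-tree≢ l
  ... | _ , is-none _ _ _ = contradiction refl kept

  kept-out-B : ∀ {v e} → ¬ X v → B.kind v ≡ out → Kept e → src G e ≡ v → B.lab e ≢ extra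
  kept-out-B {e = e} p k kept refl with label e
  ... | _ , is-real (namesA l) = contradiction (A-src (named l)) p
  ... | _ , is-real (namesB l) = named l
  ... | _ , is-real (namesCross {i} refl) = contradiction (σ∈X i) p
  ... | _ , is-real (namesBack {i} refl) =
    ⊥-elim (subst Entry (trans (cong B.kind (downs-inject₁ G return i)) k) (B.y-entry (inject₁ i)))
  ... | _ , is-treeA l = contradiction (A-src (is-tree≢ l)) p
  ... | _ , is-treeB l = is-tree≢ l
  ... | _ , is-none _ _ _ = contradiction refl kept

  vertex-cases : ∀ h → (∃[ i ] h ≡ V.a i) ⊎ (∃[ i ] h ≡ V.b i)
  vertex-cases h with splitAt (suc n) h | Fin.join-splitAt (suc n) (suc n) h
  ... | inj₁ i | eq = inj₁ (i , sym eq)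
  ... | inj₂ i | eq = inj₂ (i , sym eq)

  a≢b : ∀ {i j} → V.a i ≢ V.b j
  a≢b {i} {j} eq = contradiction (trans (sym (V.isA-a i)) (trans (cong V.isA eq) (V.isA-b j))) λ ()

  model : Model G V.H
  model = record
    { kind = kind ; φ = φ ; lab = lab
    ; real-src = λ {_} {h} l → let nz = label-names l ; (p , q) = names-src nz in
        trans p (trans (sym (V.src-name (V.unname h))) (cong (src V.H) (V.name-unname h))) , q
    ; real-tgt = λ {_} {h} l → let nz = label-names l ; (p , q) = names-tgt nz in
        trans p (trans (sym (V.tgt-name (V.unname h))) (cong (tgt V.H) (V.name-unname h))) , q
    ; tree-φ = λ l → [ treeφ-A , treeφ-B ]′ (tree-sides l)
    ; tree-kind = λ l → [ treekind-A , treekind-B ]′ (tree-sides l)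
    ; real-sur = λ h → let (e , nz) = named-edge (V.unname h) in
        e , trans (names-label nz) (cong real (V.name-unname h))
    ; real-inj = λ l l' → names-same (label-names l) (label-names l')
    ; cen-sur = centre
    ; cen-inj = centre-unique
    ; cen-s = trans (kind-A X-s) A.cen-root
    ; cen-t = trans (kind-B ¬X-t) (cong opKind (trans (cong B.kind (sym (downs-fromℕ G return))) B.cen-root))
    ; φ-s = trans (φ-A X-s) (cong V.a (A.y-φ zero))
    ; φ-t = trans (φ-B ¬X-t) (cong V.b (trans (cong B.φ (sym (downs-fromℕ G return))) (B.y-φ (fromℕ n))))
    ; out-uniq = out-unique ; inn-uniq = inn-unique
    ; has-in = into ; has-out = out-of }
    where
    treeφ-A : ∀ {e} → A.lab e ≡ tree → φ (src G e) ≡ φ (tgt G e)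
    treeφ-A l = trans (φ-A (A-src (is-tree≢ l))) (trans (cong V.a (A.tree-φ l)) (sym (φ-A (A-tgt (is-tree≢ l)))))

    treeφ-B : ∀ {e} → B.lab e ≡ tree → φ (src G e) ≡ φ (tgt G e)
    treeφ-B l = trans (φ-B (B-src (is-tree≢ l))) (trans (cong V.b (sym (B.tree-φ l))) (sym (φ-B (B-tgt (is-tree≢ l)))))

    TreeKind : Edge G → Set
    TreeKind e = (Exit (kind (src G e)) × kind (tgt G e) ≡ out) ⊎ (kind (src G e) ≡ inn × Entry (kind (tgt G e)))

    treekind-A : ∀ {e} → A.lab e ≡ tree → TreeKind e
    treekind-A {e} l rewrite kind-A (A-src (is-tree≢ l)) | kind-A (A-tgt (is-tree≢ l)) = A.tree-kind l

    treekind-B : ∀ {e} → B.lab e ≡ tree → TreeKind e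
    treekind-B {e} l rewrite kind-B (B-src (is-tree≢ l)) | kind-B (B-tgt (is-tree≢ l)) with B.tree-kind l
    ... | inj₁ (p , q) = inj₂ (cong opKind q , opKind-entry p)
    ... | inj₂ (p , q) = inj₁ (opKind-exit q , cong opKind p)

    centre : ∀ h → ∃[ v ] (kind v ≡ cen × φ v ≡ h)
    centre h with vertex-cases h
    ... | inj₁ (i , refl) = let (v , k , eq) = A.cen-sur i
                                v∈X = A.in-X (λ q → contradiction (trans (sym k) q) λ ())
                            in v , trans (kind-A v∈X) k , trans (φ-A v∈X) (cong V.a eq)
    ... | inj₂ (i , refl) = let (v , k , eq) = B.cen-sur i
                                v∉X = B.in-X (λ q → contradiction (trans (sym k) q) λ ())
                            in v , trans (kind-B v∉X) (cong opKind k) , trans (φ-B v∉X) (cong V.b eq)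

    centre-unique : ∀ {v v'} → kind v ≡ cen → kind v' ≡ cen → φ v ≡ φ v' → v ≡ v'
    centre-unique {v} {v'} k k' eq with X? v | X? v'
    ... | yes _ | yes _ = A.cen-inj k k' (Fin.↑ˡ-injective (suc n) _ _ eq)
    ... | yes _ | no _  = contradiction eq a≢b
    ... | no _  | yes _ = contradiction (sym eq) a≢b
    ... | no _  | no _  = B.cen-inj (opKind-flip k) (opKind-flip k') (Fin.↑ʳ-injective (suc n) _ _ eq)

    out-unique : ∀ {v e e'} → kind v ≡ out → Kept e → tgt G e ≡ v → Kept e' → tgt G e' ≡ v → e ≡ e'
    out-unique {v} k ke p ke' p' = [ inA , inB ]′ (toSum (X? v))
      where
      inA : X v → _ ≡ _
      inA v∈X = let kA = trans (sym (kind-A v∈X)) k in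
        A.out-uniq kA (kept-in-A v∈X kA ke p) p (kept-in-A v∈X kA ke' p') p'
      inB : ¬ X v → _ ≡ _
      inB v∉X = let kB = opKind-flip (trans (sym (kind-B v∉X)) k) in
        B.inn-uniq kB (kept-in-B v∉X kB ke p) p (kept-in-B v∉X kB ke' p') p'

    inn-unique : ∀ {v e e'} → kind v ≡ inn → Kept e → src G e ≡ v → Kept e' → src G e' ≡ v → e ≡ e'
    inn-unique {v} k ke p ke' p' = [ inA , inB ]′ (toSum (X? v))
      where
      inA : X v → _ ≡ _
      inA v∈X = let kA = trans (sym (kind-A v∈X)) k in
        A.inn-uniq kA (kept-out-A v∈X kA ke p) p (kept-out-A v∈X kA ke' p') p'
      inB : ¬ X v → _ ≡ _
      inB v∉X = let kB = opKind-flip (trans (sym (kind-B v∉X)) k) in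
        B.out-uniq kB (kept-out-B v∉X kB ke p) p (kept-out-B v∉X kB ke' p') p'

    junk-A : ∀ {v} → X v → kind v ≢ junk → A.kind v ≢ junk
    junk-A v∈X k q = k (trans (kind-A v∈X) q)

    junk-B : ∀ {v} → ¬ X v → kind v ≢ junk → B.kind v ≢ junk
    junk-B v∉X k q = k (trans (kind-B v∉X) (cong opKind q))

    into : ∀ {v} → kind v ≢ junk → v ≢ s G → ∃[ e ] (Kept e × tgt G e ≡ v)
    into {v} k v≢s = [ inA , inB ]′ (toSum (X? v))
      where
      inA : X v → ∃[ e ] (Kept e × tgt G e ≡ v)
      inA v∈X with A.has-in (junk-A v∈X k) v≢s
      ... | inj₁ (e , ke , eq) = e , A-kept ke , eq
      -- The starts exempted on this side are exactly the heads of the return edges.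
      ... | inj₂ (j , eq) = return j , names-kept (namesBack refl) , sym eq
      inB : ¬ X v → ∃[ e ] (Kept e × tgt G e ≡ v)
      inB v∉X with B.has-out (junk-B v∉X k)
      ... | inj₁ (e , ke , eq) = e , B-kept ke , eq
      ... | inj₂ (i , eq) = rung i , names-kept (namesCross refl) , sym eq

    out-of : ∀ {v} → kind v ≢ junk → v ≢ t G → ∃[ e ] (Kept e × src G e ≡ v)
    out-of {v} k v≢t = [ inA , inB ]′ (toSum (X? v))
      where
      inA : X v → ∃[ e ] (Kept e × src G e ≡ v)
      inA v∈X with A.has-out (junk-A v∈X k)
      ... | inj₁ (e , ke , eq) = e , A-kept ke , eq
      ... | inj₂ (i , eq) = rung i , names-kept (namesCross refl) , sym eq
      inB : ¬ X v → ∃[ e ] (Kept e × src G e ≡ v)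
      inB v∉X with B.has-in (junk-B v∉X k) (λ q → v≢t (trans q (downs-fromℕ G return)))
      ... | inj₁ (e , ke , eq) = e , B-kept ke , eq
      ... | inj₂ (j , eq) = return j , names-kept (namesBack refl) , sym (trans eq (downs-inject₁ G return j))

  variant-minor : SomeSPVariantDMinor (suc n) G
  variant-minor = n , refl , A.par , B.par , valid , model⇒minor (ne G) refl F model

-- The two sides of a minimal cut

SPW⇒variant-minor : ∀ {G n} → Flow G → SPW≥ G (suc n) → SomeSPVariantDMinor (suc n) G
SPW⇒variant-minor {G} {n} F (S , (es , (ok , _) , S⊆es) , (C , (cut , minimal) , S⊆C) , size) =
  FromLadder.variant-minor F X? X-s (λ x → x (B.base refl)) C C-src (λ m x → x (C-tgt m)) from to (K.ladder (climbing (K.last-crossings n crossed (ℕ.≤-trans size enough))))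
  where
  reachable : Closure G (_≡ s G) (λ e → ¬ e Sub.∈ C)
  reachable = closure G (_≟ s G) (λ e → ¬? (e ∈? C))
  module R = Closure reachable

  coreachable : Closure (op G) (_≡ t G) (λ e → ¬ e Sub.∈ C)
  coreachable = closure (op G) (_≟ t G) (λ e → ¬? (e ∈? C))
  module B = Closure coreachable

  -- A vertex between `B` and `R`, such as one subdividing a return edge, lies in neither set.
  -- Counting it on the source side splits all vertices in two while every edge leaving `X` still
  -- belongs to the cut.
  X : Vertex G → Set
  X v = ¬ B.In v
  X? : Decidable X
  X? v = ¬? (B.In? v)

  avoiding : ∀ {v} → R.In v → ∃[ es ] (IsWalk G (s G) v es × All (λ e → ¬ e Sub.∈ C) es)
  avoiding = R.induct (λ v → ∃[ es ] (IsWalk G (s G) v es × All (λ e → ¬ e Sub.∈ C) es))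
    (λ { refl → [] , refl , [] })
    (λ { e a _ (es , ok , al) → es ++ e ∷ [] , walk-++ es (e ∷ []) ok (refl , refl)
                              , All-++⁺ al (a ∷ []) })

  t∉R : ¬ R.In (t G)
  t∉R r with avoiding r
  ... | es , ok , al = All.lookupWith (λ n i → n i) al (cut es (ok , walk-simple F es ok))

  R⊆X : ∀ {v} → R.In v → X v
  R⊆X r b = B.induct (λ v → ¬ R.In v) (λ { refl → t∉R }) (λ e a _ n r → n (R.closed e a r)) b r

  X-s : X (s G)
  X-s = R⊆X (R.base refl)

  module _ {e : Edge G} (m : e Sub.∈ C) where
    Other? : Decidable (λ x → x Sub.∈ C × x ≢ e)
    Other? x = (x ∈? C) ×-dec ¬? (x ≟ e)

    no-cut-without : ¬ (∀ es → IsSTPath G es → Any (λ x → x Sub.∈ C × x ≢ e) es)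
    no-cut-without c = minimal (subsetOf Other?)
      ((λ x → proj₁ (∈-subsetOf⁻ Other? x)) , e , m , λ x → proj₂ (∈-subsetOf⁻ Other? x) refl)
      (λ es p → Any.map (∈-subsetOf⁺ Other?) (c es p))

    -- Each path leaves `R` through an edge of `C`. If the tail of `e` were outside `R`, that edge
    -- would never be `e`, and `C` without `e` would still be a cut.
    C-src-R : R.In (src G e)
    C-src-R = decidable-stable (R.In? (src G e)) λ n → no-cut-without λ es p →
      Any.map (λ { {x} (r , nr) → decidable-stable (x ∈? C) (λ n → nr (R.closed x n r)) , λ { refl → n r } })
        (walk-leaves R.In? es (proj₁ p) (R.base refl) t∉R)

    C-tgt : B.In (tgt G e)
    C-tgt = decidable-stable (B.In? (tgt G e)) λ n → no-cut-without λ es p →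
      Any.map (λ { {x} (nb , b) → decidable-stable (x ∈? C) (λ n → nb (B.closed x n b)) , λ { refl → n b } })
        (walk-enters B.In? es (proj₁ p) X-s (B.base refl))

  C-src : ∀ {e} → e Sub.∈ C → X (src G e)
  C-src m = R⊆X (C-src-R m)

  crossing : ∀ {e} → X (src G e) → ¬ X (tgt G e) → e Sub.∈ C
  crossing {e} p q = decidable-stable (e ∈? C) λ n →
    p (B.closed e n (decidable-stable (B.In? (tgt G e)) q))

  from : ∀ {e} → e Sub.∈ C → Walk G X (s G) (src G e)
  from m = R.induct (Walk G X (s G)) (λ { refl → ε })
    (λ e a r w → w ◅◅ edgeWalk {G} e (R⊆X r) (R⊆X (R.closed e a r))) (C-src-R m)

  to : ∀ {e} → e Sub.∈ C → Walk G (¬_ ∘ X) (tgt G e) (t G)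
  to m = B.induct (λ v → Walk G (¬_ ∘ X) v (t G)) (λ { refl → ε })
    (λ e a b w → edgeWalk {G} e (λ x → x (B.closed e a b)) (λ x → x b) ◅◅ w) (C-tgt m)

  module K = Crossings G X? (λ x → x (B.base refl)) C crossing C-src (λ m x → x (C-tgt m))

  crosses : K.Crosses S (s G)
  crosses = K.crosses es ok S S⊆C (λ {e} m → S⊆es e m)

  enough : ∣ S ∣ ≤ proj₁ crosses
  enough = proj₁ (proj₂ crosses)

  crossed : K.Up (s G) (proj₁ crosses)
  crossed = proj₁ (proj₂ (proj₂ crosses)) X-s

  -- The crossings before the last n + 1 are bypassed inside X.
  climbing : ∃[ u ] K.Up u (suc n) → K.Up (s G) (suc n)
  climbing (u , K.over e _ m d) = K.over e (from m) m d

theorem23 : (G : Graph) → TDAG G → (k : ℕ) → 2 ≤ k →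
            SPW≥ G k ⇔ SomeSPVariantDMinor k G
theorem23 G T (suc n) _ = mk⇔ (SPW⇒variant-minor (TDAG⇒Flow T)) (variant-minor⇒SPW (TDAG⇒Flow T))
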